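{- Consider an instance of Restricted Assignment with $n$ jobs and $m$ machines, a (possibly infeasible) predicted assignment $\hat\pi:[n]\to[m]$, a parameter $\varepsilon\in(0,1)$ and a threshold $T$. Assume that $T\ge \mathrm{OPT}$ and $\Delta(T)>0$. Then the algorithm GlobalRepairJobs$(T,\hat\pi,\varepsilon)$ returns a feasible schedule $\sigma$ with $C_{\max}(\sigma)\le (1+\varepsilon)T$ in time $$\widetilde{O}\!\left(n\cdot m^{O(\mathcal{E}_J)}\cdot\left(\frac{\mathcal{E}_J}{\varepsilon}\right)^{O(\mathcal{E}_J)}\right),$$ where $\widetilde{O}(\cdot)$ hides logarithmic factors.
   Context: Restricted Assignment: there are $n$ jobs and $m$ machines. Each job $j\in[n]$ has an integer processing time $p_j\in\mathbb{Z}_{\ge 1}$ and a nonempty set $\Gamma(j)\subseteq[m]$ of eligible machines. A schedule $\sigma:[n]\to[m]$ is feasible if $\sigma(j)\in\Gamma(j)$ for all $j$. Write $L_i(\sigma)=\sum_{j:\sigma(j)=i}p_j$, $C_{\max}(\sigma)=\max_{i\in[m]}L_i(\sigma)$, and $\mathrm{OPT}=\min\{C_{\max}(\sigma):\sigma\text{ feasible}\}$. For a feasible schedule $\sigma$ and any map $\tau:[n]\to[m]$, $\mathrm{moveJobs}(\sigma,\tau)=|\{j\in[n]:\sigma(j)\ne\tau(j)\}|$. The moved-job prediction error is $\mathcal{E}_J=\min\{\mathrm{moveJobs}(\sigma^*,\hat\pi):\sigma^*\text{ feasible and }C_{\max}(\sigma^*)=\mathrm{OPT}\}$; it is not known to the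 algorithm. $\mathsf{Project}(\hat\pi)$: process the jobs one by one in a fixed arbitrary order; if $\hat\pi(j)\in\Gamma(j)$, set $\hat\sigma(j)=\hat\pi(j)$; otherwise assign $j$ to a currently least-loaded machine of $\Gamma(j)$ (ties arbitrary). Let $\hat\sigma=\mathsf{Project}(\hat\pi)$, $\hat L_i=L_i(\hat\sigma)$, $O(T)=\{i\in[m]:\hat L_i>T\}$, and $\Delta(T)=\sum_{i\in[m]}\max\{\hat L_i-T,0\}$. Fixed-set procedure: for an integer $M\ge1$ and a nonempty $A\subseteq[m]$ with $O(T)\subseteq A$, let $J_A=\{j:\hat\sigma(j)\in A\}$ and $B=\lceil 3M^2/\varepsilon\rceil$. There is a dynamic program running in time $O(|J_A|\cdot|A|\cdot(2B+1)^{|A|-1})$ that outputs either Fail or a feasible schedule $\sigma$ with (1) $\sigma(j)=\hat\sigma(j)$ for $j\notin J_A$; (2) $\sigma(j)\in\Gamma(j)\cap A$ for $j\in J_A$; (3) $\mathrm{moveJobs}(\sigma,\hat\sigma)\le M$; (4) $C_{\max}(\sigma)\le(1+\varepsilon)T$; and it does not output Fail if there is a feasible schedule $\sigma'$ satisfying (1)--(3) with $C_{\max}(\sigma')\le T$. GlobalRepairOracle$_J(T,M,\varepsilon,\hat\sigma)$: enumerate all sets $A\subseteq[m]$ with $O(T)\subseteq A$ and $|A|\le 2M$, run the fixed-set procedure for each, and return the first schedule found, or Fail if none is found (if $|O(T)|>2M$ return Fail immediately). GlobalRepairJobs$(T,\hat\pi,\varepsilon)$: compute $\hat\sigma=\mathsf{Project}(\hat\pi)$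 and $\Delta(T)$. If $\Delta(T)=0$, return $\hat\sigma$. Otherwise set $M=1$ and repeat: call GlobalRepairOracle$_J(T,M,\varepsilon,\hat\sigma)$; if it returns a schedule, return it; otherwise set $M\leftarrow 2M$.
   Formalization: The parameter ε and the threshold T are taken to be rational numbers instead of real numbers. -}

module Defs where

open import Algebra.Definitions.RawSemiring using (_^_)
open import Data.Bool.Base using (Bool; if_then_else_; _∧_; _∨_)
open import Data.Fin.Base using (Fin)
open import Data.Fin.Properties using (_≟_)
open import Data.Fin.Subset using (Subset; inside; outside; _∈_; _∉_; _⊆_; ∣_∣; Nonempty)
open import Data.Fin.Subset.Properties using (_∈?_)
import Data.Integer.Base as ℤ
open import Data.List.Base using (List; []; _∷_; _++_; map; filter; foldr; sum; length; allFin)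
open import Data.List.Extrema.Nat using (max)
open import Data.List.Relation.Binary.Permutation.Propositional using (_↭_)
open import Data.Maybe.Base using (Maybe; just; nothing)
import Data.Nat.Base as ℕ
open import Data.Nat.Base using (ℕ; zero; suc)
open import Data.Nat.Logarithm using (⌈log₂_⌉)
import Data.Nat.Properties as ℕ
open import Data.Product.Base using (∃-syntax; _×_; _,_; proj₁)
import Data.Rational.Base as ℚ
open import Data.Rational.Base using (ℚ; 0ℚ; 1ℚ)
import Data.Rational.Properties as ℚ
import Data.Vec.Base as Vec
open import Data.Unit.Base using (⊤; tt)
open import Data.Vec.Functional using (updateAt)
open import Function.Base using (const)
open import Relation.Binary.PropositionalEquality.Core using (_≡_; _≢_)
open import Relation.Nullary.Decidable using (does; ¬?)

⟦_⟧ : ℕ → ℚ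
⟦ k ⟧ = ℤ.+ k ℚ./ 1

infixr 8 _^ℚ_
_^ℚ_ : ℚ → ℕ → ℚ
_^ℚ_ = _^_ ℚ.+-*-rawSemiring

infixl 7 _/ℚ_
_/ℚ_ : ℚ → (q : ℚ) .{{_ : ℚ.Positive q}} → ℚ
x /ℚ q = (x ℚ.÷ q) {{ℚ.pos⇒nonZero q}}

record IsMinimum {X : Set} (P : X → Set) (f : X → ℕ) (v : ℕ) : Set where
  field
    attained   : ∃[ x ] P x × f x ≡ v
    lowerBound : ∀ x → P x → v ℕ.≤ f x

record Instance (n m : ℕ) : Set where
  field
    p          : Fin n → ℕ
    p≥1        : ∀ j → 1 ℕ.≤ p j
    Γ          : Fin n → Subset m
    Γ-nonempty : ∀ j → Nonempty (Γ j)

Assignment : ℕ → ℕ → Set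
Assignment n m = Fin n → Fin m

moveJobs : ∀ {n m} → Assignment n m → Assignment n m → ℕ
moveJobs {n} σ τ = length (filter (λ j → ¬? (σ j ≟ τ j)) (allFin n))

jobsOn : ∀ {n m} → Assignment n m → Subset m → List (Fin n)
jobsOn {n} σ A = filter (λ j → σ j ∈? A) (allFin n)

module _ {n m : ℕ} (I : Instance n m) where
  open Instance I

  Feasible : Assignment n m → Set
  Feasible σ = ∀ j → σ j ∈ Γ j

  load : Assignment n m → Fin m → ℕ
  load σ i = sum (map p (filter (λ j → σ j ≟ i) (allFin n)))

  Cmax : Assignment n m → ℕ
  Cmax σ = max 0 (map (load σ) (allFin m))

  IsOPT : ℕ → Set
  IsOPT = IsMinimum Feasible Cmax

  Optimal : Assignment n m → Set
  Optimal σ = Feasible σ × IsOPT (Cmax σ)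

  IsMovedJobError : Assignment n m → ℕ → Set
  IsMovedJobError π̂ = IsMinimum Optimal (λ σ* → moveJobs σ* π̂)

  overloaded : ℚ → Assignment n m → Subset m
  overloaded T σ = Vec.tabulate (λ i → does (T ℚ.<? ⟦ load σ i ⟧))

  excess : ℚ → Assignment n m → ℚ
  excess T σ = foldr ℚ._+_ 0ℚ (map (λ i → (⟦ load σ i ⟧ ℚ.- T) ℚ.⊔ 0ℚ) (allFin m))

-- Cost model: a computation returns a value together with the number of
-- elementary steps used.  Arithmetic, comparisons, array accesses and list
-- operations have unit cost, as on a RAM.

infix 4 _after_
record Timed (X : Set) : Set where
  constructor _after_
  field
    value : X
    steps : ℕ
open Timed public

infixl 1 _>>=_ _>>_

return : ∀ {X} → X → Timed X
return x = x after 0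

charge : ∀ {X} → ℕ → X → Timed X
charge k x = x after k

_>>=_ : ∀ {X Y} → Timed X → (X → Timed Y) → Timed Y
c >>= f = value (f (value c)) after steps c ℕ.+ steps (f (value c))

_>>_ : ∀ {X Y} → Timed X → Timed Y → Timed Y
c >> d = c >>= const d

tick : Timed ⊤
tick = charge 1 tt

mapT : ∀ {X Y : Set} → (X → Y) → List X → Timed (List Y)
mapT f xs = charge (length xs) (map f xs)

_++T_ : ∀ {X : Set} → List X → List X → Timed (List X)
xs ++T ys = charge (length xs) (xs ++ ys)

-- The two arbitrary choices.  Any least-loaded machine can be made the outcome
-- for a job by a suitable `prefer`, which is consulted on equal loads only.
record ProjectRule (n m : ℕ) : Set where
  field
    order    : List (Fin n)
    complete : order ↭ allFin n
    prefer   : (j : Fin n) (new current : Fin m) → Bool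

module _ {n m : ℕ} (I : Instance n m) (rule : ProjectRule n m) (π̂ : Assignment n m) where
  open Instance I
  open ProjectRule rule

  better : Fin n → (ℓ : Fin m → ℕ) (new current : Fin m) → Bool
  better j ℓ i b =
    does (i ∈? Γ j) ∧ (does (ℓ i ℕ.<? ℓ b) ∨ (does (ℓ i ℕ.≟ ℓ b) ∧ prefer j i b))

  scan : Fin n → (Fin m → ℕ) → List (Fin m) → Fin m → Timed (Fin m)
  scan j ℓ []       b = return b
  scan j ℓ (i ∷ is) b = do
    tick
    scan j ℓ is (if better j ℓ i b then i else b)

  leastLoaded : Fin n → (Fin m → ℕ) → Timed (Fin m)
  leastLoaded j ℓ = scan j ℓ (allFin m) (proj₁ (Γ-nonempty j))

  target : Fin n → (Fin m → ℕ) → Timed (Fin m)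
  target j ℓ = do
    tick
    if does (π̂ j ∈? Γ j) then return (π̂ j) else leastLoaded j ℓ

  -- `ℓ` holds the loads of the jobs processed so far; entries of `σ` at
  -- unprocessed jobs are still those of π̂ and have no influence.
  assign : List (Fin n) → Assignment n m → (Fin m → ℕ) → Timed (Assignment n m)
  assign []       σ ℓ = return σ
  assign (j ∷ js) σ ℓ = do
    i ← target j ℓ
    tick
    assign js (updateAt σ j (const i)) (updateAt ℓ i (ℕ._+ p j))

  -- The initial charge is for creating the arrays σ and ℓ.
  project : Timed (Assignment n m)
  project = do
    σ ← charge (n ℕ.+ m) π̂
    assign order σ (const 0)

gridSize : ℕ → (ε : ℚ) .{{_ : ℚ.Positive ε}} → ℕ
gridSize M ε = ℤ.∣ ℚ.ceiling (⟦ 3 ℕ.* M ℕ.^ 2 ⟧ /ℚ ε) ∣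

record LocalRepair {n m : ℕ} (I : Instance n m) (σ̂ : Assignment n m) (M : ℕ) (A : Subset m)
                   (σ : Assignment n m) : Set where
  field
    feasible : Feasible I σ
    outside≡ : ∀ j → σ̂ j ∉ A → σ j ≡ σ̂ j
    inside∈  : ∀ j → σ̂ j ∈ A → σ j ∈ A
    moves    : moveJobs σ σ̂ ℕ.≤ M

-- What the dynamic program promises for its outcome on one input; `nothing`
-- stands for Fail and `factor` for the constant hidden in the running time.
record Guarantee (factor : ℕ) {n m : ℕ} (I : Instance n m) (T ε : ℚ) .{{_ : ℚ.Positive ε}}
                 (σ̂ : Assignment n m) (M : ℕ) (A : Subset m)
                 (outcome : Timed (Maybe (Assignment n m))) : Set where
  field
    sound    : ∀ {σ} → value outcome ≡ just σ →
               LocalRepair I σ̂ M A σ × ⟦ Cmax I σ ⟧ ℚ.≤ (1ℚ ℚ.+ ε) ℚ.* T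
    complete : ∀ {σ′} → LocalRepair I σ̂ M A σ′ → ⟦ Cmax I σ′ ⟧ ℚ.≤ T →
               value outcome ≢ nothing
    fast     : steps outcome ℕ.≤
               factor ℕ.* (length (jobsOn σ̂ A) ℕ.* ∣ A ∣ ℕ.*
                           (2 ℕ.* gridSize M ε ℕ.+ 1) ℕ.^ (∣ A ∣ ℕ.∸ 1))

record FixedSetProcedure : Set where
  field
    run : ∀ {n m} (I : Instance n m) (T ε : ℚ) .{{_ : ℚ.Positive ε}}
          (σ̂ : Assignment n m) (M : ℕ) (A : Subset m) → Timed (Maybe (Assignment n m))
    factor : ℕ
    guarantee : ∀ {n m} (I : Instance n m) (T ε : ℚ) .{{_ : ℚ.Positive ε}} → ε ℚ.< 1ℚ →
                (σ̂ : Assignment n m) → Feasible I σ̂ →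
                (M : ℕ) → 1 ℕ.≤ M →
                (A : Subset m) → Nonempty A → overloaded I T σ̂ ⊆ A →
                Guarantee factor I T ε σ̂ M A (run I T ε σ̂ M A)

-- Lists the sets A with O ⊆ A and ∣ A ∣ ≤ k by branching on the machines, so that
-- its cost is polynomial in m for fixed k (filtering all subsets would cost 2 ^ m).
supersets : ∀ {m} → Subset m → ℕ → Timed (List (Subset m))
supersets Vec.[] k = do
  tick
  return (Vec.[] ∷ [])
supersets (inside Vec.∷ O) zero = do
  tick
  return []
supersets (inside Vec.∷ O) (suc k) = do
  tick
  As ← supersets O k
  mapT (inside Vec.∷_) As
supersets (outside Vec.∷ O) zero = do
  tick
  As ← supersets O zero
  mapT (outside Vec.∷_) As
supersets (outside Vec.∷ O) (suc k) = do
  tick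
  As ← supersets O k
  Bs ← supersets O (suc k)
  As′ ← mapT (inside Vec.∷_) As
  Bs′ ← mapT (outside Vec.∷_) Bs
  As′ ++T Bs′

firstSuccess : ∀ {X Y : Set} → (X → Timed (Maybe Y)) → List X → Timed (Maybe Y)
firstSuccess f []       = return nothing
firstSuccess {X} {Y} f (x ∷ xs) = do
  tick
  r ← f x
  continue r
  where
  continue : Maybe Y → Timed (Maybe Y)
  continue (just y) = return (just y)
  continue nothing  = firstSuccess f xs

module _ (P : FixedSetProcedure) {n m : ℕ} (I : Instance n m) (T ε : ℚ) .{{_ : ℚ.Positive ε}} where

  -- Each of the m loads is evaluated by a scan of the jobs and compared with T;
  -- counting the elements of O costs another m.
  globalRepairOracle : (M : ℕ) (σ̂ : Assignment n m) → Timed (Maybe (Assignment n m))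
  globalRepairOracle M σ̂ = do
    O ← charge (n ℕ.* m ℕ.+ m) (overloaded I T σ̂)
    size ← charge m ∣ O ∣
    if does (2 ℕ.* M ℕ.<? size)
      then return nothing
      else (supersets O (2 ℕ.* M) >>=
            firstSuccess (FixedSetProcedure.run P I T ε σ̂ M))

  -- `Repeat σ̂ M σ t`: the loop entered with the value M terminates after t steps
  -- and returns σ.
  data Repeat (σ̂ : Assignment n m) (M : ℕ) : Assignment n m → ℕ → Set where
    found : ∀ {σ} → value (globalRepairOracle M σ̂) ≡ just σ →
            Repeat σ̂ M σ (1 ℕ.+ steps (globalRepairOracle M σ̂))
    again : ∀ {σ t} → value (globalRepairOracle M σ̂) ≡ nothing →
            Repeat σ̂ (2 ℕ.* M) σ t →
            Repeat σ̂ M σ (1 ℕ.+ steps (globalRepairOracle M σ̂) ℕ.+ t)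

  -- `GlobalRepairJobs rule π̂ σ t`: the algorithm terminates after t steps and
  -- returns σ.  Computing Δ(T) costs n * m for the loads and m for the sum.
  data GlobalRepairJobs (rule : ProjectRule n m) (π̂ : Assignment n m) :
                        Assignment n m → ℕ → Set where
    unchanged : let σ̂ = project I rule π̂ in
                excess I T (value σ̂) ≡ 0ℚ →
                GlobalRepairJobs rule π̂ (value σ̂) (steps σ̂ ℕ.+ (n ℕ.* m ℕ.+ m))
    repaired  : let σ̂ = project I rule π̂ in
                ∀ {σ t} → excess I T (value σ̂) ≢ 0ℚ →
                Repeat (value σ̂) 1 σ t →
                GlobalRepairJobs rule π̂ σ (steps σ̂ ℕ.+ (n ℕ.* m ℕ.+ m) ℕ.+ t)

polylog : ℕ → ℚ → ℚ
polylog k x = ⟦ (1 ℕ.+ ⌈log₂ ℤ.∣ ℚ.ceiling x ∣ ⌉) ℕ.^ k ⟧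

-- n · m^(a E) · (E / ε)^(b E)
repairBound : (a b n m E : ℕ) (ε : ℚ) .{{_ : ℚ.Positive ε}} → ℚ
repairBound a b n m E ε =
  ⟦ n ⟧ ℚ.* ⟦ m ℕ.^ (a ℕ.* E) ⟧ ℚ.* (⟦ E ⟧ /ℚ ε) ^ℚ (b ℕ.* E)

{-# OPTIONS --safe #-}
module Submission where

-- Let σ* be an optimal schedule at distance E from π̂.  Project changes π̂ only where it is
-- infeasible, hence different from σ*, so σ* is also within E moves of σ̂.  The at most 2E
-- machines touched by these moves include O(T), since every overloaded machine has to lose a
-- job on the way to σ*; with A the set of these machines, σ* is a witness that the oracle
-- succeeds as soon as M ≥ E.  The doubling therefore stops with M < 2E, when there
-- are at most (m + 1)^(4E) sets A, and 2B + 1 ≤ 64 (E / ε)².  Moreover Δ(T) > 0 forces E ≥ 1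
-- and m ≥ 2, so constant factors to the power E are absorbed by m^O(E) and no logarithm is
-- needed in the bound.

open import Algebra.Bundles using (module CommutativeRing)
import Algebra.Properties.CommutativeSemiring.Exp as Exp
import Data.Bool.Base as Bool
open import Data.Bool.Base using (true; false; if_then_else_)
open import Data.Fin.Base using (Fin; zero; suc)
open import Data.Fin.Properties using (_≟_; any?)
open import Data.Fin.Subset using (Subset; inside; outside; ⁅_⁆; _∪_; ⋃; _∈_; _⊆_; ∣_∣; Nonempty)
open import Data.Fin.Subset.Properties
  using (_∈?_; ∣p∣≤n; ∣p∣≤∣x∷p∣; ∣⊥∣≡0; x∈p∪q⁺; x∈⁅x⁆; ∣⁅x⁆∣≡1; ⊆-refl; in⊆in; out⊆; drop-∷-⊆; p⊆q⇒∣p∣≤∣q∣)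
import Data.Integer.Base as ℤ
import Data.Integer.DivMod as ℤ
import Data.Integer.Properties as ℤ
open import Data.List.Base using (List; []; _∷_; map; filter; foldr; length; allFin)
open import Data.List.Extrema.Nat using (xs≤max)
import Data.List.Membership.Propositional as List
open import Data.List.Membership.Propositional.Properties
  using (∈-filter⁺; ∈-allFin; ∈-map⁺; ∈-map⁻; ∈-++⁺ˡ; ∈-++⁺ʳ; ∈-++⁻)
import Data.List.Properties as List
open import Data.List.Relation.Binary.Permutation.Propositional using (↭-sym)
open import Data.List.Relation.Binary.Permutation.Propositional.Properties using (∈-resp-↭; ↭-length)
import Data.List.Relation.Binary.Sublist.Propositional as Sublist
open import Data.List.Relation.Binary.Sublist.Propositional.Properties using (length-mono-≤; filter⁺)
import Data.List.Relation.Unary.All as All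
open import Data.List.Relation.Unary.Any using (here; there)
open import Data.Maybe.Base using (Maybe; just; nothing)
import Data.Nat.Base as ℕ
open import Data.Nat.Base using (ℕ; zero; suc; z≤n; s≤s)
import Data.Nat.Coprimality as Coprime
open import Data.Nat.ListAction using (sum)
import Data.Nat.Properties as ℕ
import Data.Nat.Solver
open import Data.Product.Base as Product using (∃-syntax; _×_; _,_; proj₁; proj₂)
import Data.Rational.Base as ℚ
open import Data.Rational.Base using (ℚ; 0ℚ; 1ℚ; Positive)
import Data.Rational.Properties as ℚ
import Data.Rational.Solver
open import Data.Sum.Base using (_⊎_; inj₁; inj₂; [_,_]′)
import Data.Vec.Base as Vec
open import Data.Vec.Functional using (updateAt)
open import Data.Vec.Functional.Properties using (updateAt-updates; updateAt-minimal)
open import Data.Vec.Properties using (lookup∘tabulate; lookup⇒[]=; []=⇒lookup)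
open import Function.Base using (id; const)
open import Relation.Binary.PropositionalEquality
  using (_≡_; _≢_; refl; sym; trans; cong; cong₂; subst; subst₂)
open import Relation.Nullary using (Dec; yes; no; does; contradiction)
open import Relation.Nullary.Decidable using (dec-true; dec-false; ¬?; _×-dec_; decidable-stable)
open import Relation.Unary using (Decidable)
open import Defs

module ℕS = Data.Nat.Solver.+-*-Solver
module ℚS = Data.Rational.Solver.+-*-Solver
module ℚ^ = Exp (CommutativeRing.commutativeSemiring ℚ.+-*-commutativeRing)

-- Schedules and loads

sum-filter-mono : ∀ {X : Set} {P Q : X → Set} (P? : Decidable P) (Q? : Decidable Q) (f : X → ℕ) xs →
                  (∀ x → P x → Q x) → sum (map f (filter P? xs)) ℕ.≤ sum (map f (filter Q? xs))
sum-filter-mono P? Q? f []       P⇒Q = z≤n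
sum-filter-mono P? Q? f (x ∷ xs) P⇒Q with P? x | Q? x
... | yes _  | yes _  = ℕ.+-monoʳ-≤ (f x) (sum-filter-mono P? Q? f xs P⇒Q)
... | yes Px | no ¬Qx = contradiction (P⇒Q x Px) ¬Qx
... | no _   | yes _  = ℕ.m≤n⇒m≤o+n (f x) (sum-filter-mono P? Q? f xs P⇒Q)
... | no _   | no _   = sum-filter-mono P? Q? f xs P⇒Q

∣p∪q∣≤∣p∣+∣q∣ : ∀ {m} (p q : Subset m) → ∣ p ∪ q ∣ ℕ.≤ ∣ p ∣ ℕ.+ ∣ q ∣
∣p∪q∣≤∣p∣+∣q∣ Vec.[]              Vec.[]              = z≤n
∣p∪q∣≤∣p∣+∣q∣ (inside  Vec.∷ p) (y       Vec.∷ q) =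
  s≤s (ℕ.≤-trans (∣p∪q∣≤∣p∣+∣q∣ p q) (ℕ.+-monoʳ-≤ ∣ p ∣ (∣p∣≤∣x∷p∣ y q)))
∣p∪q∣≤∣p∣+∣q∣ (outside Vec.∷ p) (inside  Vec.∷ q) =
  subst (suc ∣ p ∪ q ∣ ℕ.≤_) (sym (ℕ.+-suc ∣ p ∣ ∣ q ∣)) (s≤s (∣p∪q∣≤∣p∣+∣q∣ p q))
∣p∪q∣≤∣p∣+∣q∣ (outside Vec.∷ p) (outside Vec.∷ q) = ∣p∪q∣≤∣p∣+∣q∣ p q

module _ {X : Set} {m : ℕ} (S : X → Subset m) where

  ∣⋃∣≤ : ∀ {c} → (∀ x → ∣ S x ∣ ℕ.≤ c) → ∀ xs → ∣ ⋃ (map S xs) ∣ ℕ.≤ length xs ℕ.* c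
  ∣⋃∣≤ ∣S∣≤ []       = ℕ.≤-reflexive (∣⊥∣≡0 m)
  ∣⋃∣≤ ∣S∣≤ (x ∷ xs) = ℕ.≤-trans (∣p∪q∣≤∣p∣+∣q∣ (S x) (⋃ (map S xs)))
    (ℕ.+-mono-≤ (∣S∣≤ x) (∣⋃∣≤ ∣S∣≤ xs))

  ∈-⋃⁺ : ∀ {x xs i} → x List.∈ xs → i ∈ S x → i ∈ ⋃ (map S xs)
  ∈-⋃⁺ (here refl)  i∈ = x∈p∪q⁺ (inj₁ i∈)
  ∈-⋃⁺ (there x∈xs) i∈ = x∈p∪q⁺ (inj₂ (∈-⋃⁺ x∈xs i∈))

module _ {n m : ℕ} (σ τ : Assignment n m) where

  -- The list counted by `moveJobs`, so that `length moved` is `moveJobs σ τ` by definition.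
  moved : List (Fin n)
  moved = filter (λ j → ¬? (σ j ≟ τ j)) (allFin n)

  ∈-moved : ∀ {j} → σ j ≢ τ j → j List.∈ moved
  ∈-moved {j} = ∈-filter⁺ (λ j → ¬? (σ j ≟ τ j)) (∈-allFin j)

  -- Both machines of a moved job are included. For `σ = σ*` and `τ = σ̂`, the machines `τ j` cover
  -- the overloaded ones and the machines `σ j` keep the moved jobs inside the set.
  touched : Subset m
  touched = ⋃ (map (λ j → ⁅ σ j ⁆ ∪ ⁅ τ j ⁆) moved)

  ∈-touchedˡ : ∀ {j} → σ j ≢ τ j → σ j ∈ touched
  ∈-touchedˡ {j} σj≢τj = ∈-⋃⁺ _ (∈-moved σj≢τj) (x∈p∪q⁺ (inj₁ (x∈⁅x⁆ (σ j))))

  ∈-touchedʳ : ∀ {j} → σ j ≢ τ j → τ j ∈ touched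
  ∈-touchedʳ {j} σj≢τj = ∈-⋃⁺ _ (∈-moved σj≢τj) (x∈p∪q⁺ (inj₂ (x∈⁅x⁆ (τ j))))

  ∣touched∣≤ : ∣ touched ∣ ℕ.≤ 2 ℕ.* moveJobs σ τ
  ∣touched∣≤ = subst (∣ touched ∣ ℕ.≤_) (ℕ.*-comm (moveJobs σ τ) 2) (∣⋃∣≤ _ ∣pair∣≤2 moved)
    where
    ∣pair∣≤2 : ∀ j → ∣ ⁅ σ j ⁆ ∪ ⁅ τ j ⁆ ∣ ℕ.≤ 2
    ∣pair∣≤2 j = subst₂ (λ a b → ∣ ⁅ σ j ⁆ ∪ ⁅ τ j ⁆ ∣ ℕ.≤ a ℕ.+ b)
      (∣⁅x⁆∣≡1 (σ j)) (∣⁅x⁆∣≡1 (τ j)) (∣p∪q∣≤∣p∣+∣q∣ ⁅ σ j ⁆ ⁅ τ j ⁆)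

  1≤moveJobs : ∀ {j} → σ j ≢ τ j → 1 ℕ.≤ moveJobs σ τ
  1≤moveJobs σj≢τj with moved | ∈-moved σj≢τj
  ... | _ ∷ _ | _ = s≤s z≤n

-- By the contrapositive of the hypothesis, the filtered list for `τ` is a sublist of the one for
-- `τ′`.
moveJobs-mono : ∀ {n m} {σ τ τ′ : Assignment n m} → (∀ j → σ j ≡ τ′ j → σ j ≡ τ j) →
                moveJobs σ τ ℕ.≤ moveJobs σ τ′
moveJobs-mono {n = n} {σ = σ} {τ} {τ′} h = length-mono-≤
  (filter⁺ (λ j → ¬? (σ j ≟ τ j)) (λ j → ¬? (σ j ≟ τ′ j))
    (λ { {j} refl σ≢τ σ≡τ′ → σ≢τ (h j σ≡τ′) }) (Sublist.⊆-refl {x = allFin n}))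

-- Used in contrapositive form: a positive excess exposes an overloaded machine.
sum-⊔≤0 : ∀ {X : Set} {T} (f : X → ℚ) → (∀ x → f x ℚ.≤ T) →
          ∀ xs → foldr ℚ._+_ 0ℚ (map (λ x → (f x ℚ.- T) ℚ.⊔ 0ℚ) xs) ℚ.≤ 0ℚ
sum-⊔≤0 f f≤T []       = ℚ.≤-refl
sum-⊔≤0 {T = T} f f≤T (x ∷ xs) = ℚ.+-mono-≤
  (ℚ.⊔-lub (ℚ.≤-trans (ℚ.+-monoˡ-≤ (ℚ.- T) (f≤T x)) (ℚ.≤-reflexive (ℚ.+-inverseʳ T))) ℚ.≤-refl)
  (sum-⊔≤0 f f≤T xs)

module _ {m : ℕ} {P : Fin m → Set} (P? : Decidable P) where

  ∈-tabulate⁺ : ∀ {i} → P i → i ∈ Vec.tabulate (λ i → does (P? i))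
  ∈-tabulate⁺ {i} Pi = lookup⇒[]= i _ (trans (lookup∘tabulate _ i) (dec-true (P? i) Pi))

  ∈-tabulate⁻ : ∀ {i} → i ∈ Vec.tabulate (λ i → does (P? i)) → P i
  ∈-tabulate⁻ {i} i∈ with P? i | trans (sym (lookup∘tabulate (λ i → does (P? i)) i)) ([]=⇒lookup i∈)
  ... | yes Pi | _  = Pi
  ... | no _   | ()

module _ {n m : ℕ} (I : Instance n m) where
  open Instance I

  load≤Cmax : ∀ σ i → load I σ i ℕ.≤ Cmax I σ
  load≤Cmax σ i = All.lookup (xs≤max 0 (map (load I σ) (allFin m))) (∈-map⁺ (load I σ) (∈-allFin i))

  load-mono : ∀ {σ τ i} → (∀ j → σ j ≡ i → τ j ≡ i) → load I σ i ℕ.≤ load I τ i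
  load-mono {σ} {τ} {i} = sum-filter-mono (λ j → σ j ≟ i) (λ j → τ j ≟ i) p (allFin n)

  -- If no job left `i`, every job of `σ` on `i` would also be there under `τ`, and `load-mono`
  -- would contradict the drop in load.
  leaves-larger-load : ∀ {σ τ i} → load I τ i ℕ.< load I σ i → ∃[ j ] σ j ≡ i × τ j ≢ i
  leaves-larger-load {σ} {τ} {i} τ<σ with any? (λ j → (σ j ≟ i) ×-dec ¬? (τ j ≟ i))
  ... | yes leaves = leaves
  ... | no ¬leaves = contradiction
    (load-mono (λ j σj≡i → decidable-stable (τ j ≟ i) (λ τj≢i → ¬leaves (j , σj≡i , τj≢i))))
    (ℕ.<⇒≱ τ<σ)

  module _ {T : ℚ} {σ : Assignment n m} where

    ∈-overloaded⁺ : ∀ {i} → T ℚ.< ⟦ load I σ i ⟧ → i ∈ overloaded I T σ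
    ∈-overloaded⁺ = ∈-tabulate⁺ (λ i → T ℚ.<? ⟦ load I σ i ⟧)

    ∈-overloaded⁻ : ∀ {i} → i ∈ overloaded I T σ → T ℚ.< ⟦ load I σ i ⟧
    ∈-overloaded⁻ = ∈-tabulate⁻ (λ i → T ℚ.<? ⟦ load I σ i ⟧)

    overloaded-nonempty : 0ℚ ℚ.< excess I T σ → Nonempty (overloaded I T σ)
    overloaded-nonempty 0<Δ = Product.map₂ ∈-overloaded⁺
      (decidable-stable (any? (λ i → T ℚ.<? ⟦ load I σ i ⟧)) λ none →
        ℚ.<-irrefl refl (ℚ.<-≤-trans 0<Δ
          (sum-⊔≤0 (λ i → ⟦ load I σ i ⟧) (λ i → ℚ.≮⇒≥ (λ T<load → none (i , T<load))) (allFin m))))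

-- Project

module _ {n m : ℕ} (I : Instance n m) (rule : ProjectRule n m) (π̂ : Assignment n m) where
  open Instance I
  open ProjectRule rule

  better⇒eligible : ∀ j ℓ i b → Bool.T (better I rule π̂ j ℓ i b) → i ∈ Γ j
  better⇒eligible j ℓ i b h with i ∈? Γ j
  ... | yes i∈Γ = i∈Γ

  -- The scan starts from an eligible machine, and `better` opens with the eligibility test, so the
  -- current choice never leaves `Γ j`.
  scan-eligible : ∀ j ℓ is {b} → b ∈ Γ j → value (scan I rule π̂ j ℓ is b) ∈ Γ j
  scan-eligible j ℓ []       b∈Γ = b∈Γ
  scan-eligible j ℓ (i ∷ is) {b} b∈Γ with better I rule π̂ j ℓ i b | better⇒eligible j ℓ i b
  ... | true  | i∈Γ = scan-eligible j ℓ is (i∈Γ _)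
  ... | false | _   = scan-eligible j ℓ is b∈Γ

  steps-scan : ∀ j ℓ is b → steps (scan I rule π̂ j ℓ is b) ≡ length is
  steps-scan j ℓ []       b = refl
  steps-scan j ℓ (i ∷ is) b = cong suc (steps-scan j ℓ is _)

  -- The first component makes `σ̂` feasible; the second keeps eligible predictions, which bounds
  -- the distance from `σ*` to `σ̂`.
  Projected : Fin n → Fin m → Set
  Projected j i = i ∈ Γ j × (π̂ j ∈ Γ j → i ≡ π̂ j)

  target-projected : ∀ j ℓ → Projected j (value (target I rule π̂ j ℓ))
  target-projected j ℓ with π̂ j ∈? Γ j
  ... | yes π̂j∈Γ = π̂j∈Γ , λ _ → refl
  ... | no  π̂j∉Γ = scan-eligible j ℓ (allFin m) (proj₂ (Γ-nonempty j)) , λ π̂j∈Γ → contradiction π̂j∈Γ π̂j∉Γ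

  steps-target : ∀ j ℓ → steps (target I rule π̂ j ℓ) ℕ.≤ 1 ℕ.+ m
  steps-target j ℓ with π̂ j ∈? Γ j
  ... | yes _ = s≤s z≤n
  ... | no  _ = s≤s (ℕ.≤-reflexive (trans (steps-scan j ℓ (allFin m) _) (List.length-tabulate id)))

  -- The disjunction is the loop invariant: a job is still waiting or already holds a projected
  -- machine. Since the order is complete, every job starts in the first case.
  assign-projected : ∀ js σ ℓ j → j List.∈ js ⊎ Projected j (σ j) →
                     Projected j (value (assign I rule π̂ js σ ℓ) j)
  assign-projected []       σ ℓ j (inj₂ done) = done
  assign-projected (k ∷ js) σ ℓ j todo = assign-projected js _ _ j (still (j ≟ k) todo)
    where
    i = value (target I rule π̂ k ℓ)
    still : Dec (j ≡ k) → j List.∈ k ∷ js ⊎ Projected j (σ j) →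
            j List.∈ js ⊎ Projected j (updateAt σ k (const i) j)
    still (yes refl) _ = inj₂ (subst (Projected j) (sym (updateAt-updates j σ)) (target-projected j ℓ))
    still (no j≢k) (inj₁ (here j≡k))   = contradiction j≡k j≢k
    still (no j≢k) (inj₁ (there j∈js)) = inj₁ j∈js
    still (no j≢k) (inj₂ done)         = inj₂ (subst (Projected j) (sym (updateAt-minimal j k σ j≢k)) done)

  -- Per job, at most `1 + m` steps find the target and one more tick pays for the updates.
  steps-assign : ∀ js σ ℓ → steps (assign I rule π̂ js σ ℓ) ℕ.≤ length js ℕ.* (2 ℕ.+ m)
  steps-assign []       σ ℓ = z≤n
  steps-assign (j ∷ js) σ ℓ = ℕ.≤-trans
    (ℕ.+-mono-≤ (steps-target j ℓ) (s≤s (steps-assign js _ _)))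
    (ℕ.≤-reflexive (ℕ.+-suc (suc m) (length js ℕ.* (2 ℕ.+ m))))

  project-projected : ∀ j → Projected j (value (project I rule π̂) j)
  project-projected j = assign-projected order π̂ (const 0) j (inj₁ (∈-resp-↭ (↭-sym complete) (∈-allFin j)))

  steps-project : steps (project I rule π̂) ℕ.≤ n ℕ.+ m ℕ.+ n ℕ.* (2 ℕ.+ m)
  steps-project = ℕ.+-monoʳ-≤ (n ℕ.+ m) (subst (λ k → steps (assign I rule π̂ order π̂ (const 0)) ℕ.≤ k ℕ.* (2 ℕ.+ m))
    length-order (steps-assign order π̂ (const 0)))
    where
    length-order : length order ≡ n
    length-order = trans (↭-length complete) (List.length-tabulate {n = n} id)

-- Enumeration of the candidate sets

module _ where
  open import Data.Nat.Base using (_+_; _*_; _^_; _≤_; _<_)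

  supersets-sound : ∀ {m} (O : Subset m) k {A} → A List.∈ value (supersets O k) → O ⊆ A × ∣ A ∣ ≤ k
  supersets-sound Vec.[] k (here refl) = ⊆-refl , z≤n
  supersets-sound (inside Vec.∷ O) (suc k) A∈ with ∈-map⁻ (inside Vec.∷_) A∈
  ... | _ , A′∈ , refl = Product.map in⊆in s≤s (supersets-sound O k A′∈)
  supersets-sound (outside Vec.∷ O) zero A∈ with ∈-map⁻ (outside Vec.∷_) A∈
  ... | _ , A′∈ , refl = Product.map₁ out⊆ (supersets-sound O zero A′∈)
  supersets-sound (outside Vec.∷ O) (suc k) A∈ =
    [ (λ A∈ˡ → case-in (∈-map⁻ (inside Vec.∷_) A∈ˡ)) , (λ A∈ʳ → case-out (∈-map⁻ (outside Vec.∷_) A∈ʳ)) ]′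
      (∈-++⁻ (map (inside Vec.∷_) (value (supersets O k))) A∈)
    where
    case-in : ∀ {A} → ∃[ A′ ] A′ List.∈ value (supersets O k) × A ≡ inside Vec.∷ A′ →
              outside Vec.∷ O ⊆ A × ∣ A ∣ ≤ suc k
    case-in (_ , A′∈ , refl) = Product.map out⊆ s≤s (supersets-sound O k A′∈)
    case-out : ∀ {A} → ∃[ A′ ] A′ List.∈ value (supersets O (suc k)) × A ≡ outside Vec.∷ A′ →
               outside Vec.∷ O ⊆ A × ∣ A ∣ ≤ suc k
    case-out (_ , A′∈ , refl) = Product.map₁ out⊆ (supersets-sound O (suc k) A′∈)

  supersets-complete : ∀ {m} (O : Subset m) k {A} → O ⊆ A → ∣ A ∣ ≤ k → A List.∈ value (supersets O k)
  supersets-complete Vec.[] k {Vec.[]} _ _ = here refl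
  supersets-complete (inside Vec.∷ O) k {outside Vec.∷ A} O⊆A _ = contradiction (O⊆A Vec.here) λ ()
  supersets-complete (inside Vec.∷ O) (suc k) {inside Vec.∷ A} O⊆A (s≤s ∣A∣≤k) =
    ∈-map⁺ (inside Vec.∷_) (supersets-complete O k (drop-∷-⊆ O⊆A) ∣A∣≤k)
  supersets-complete (outside Vec.∷ O) zero {outside Vec.∷ A} O⊆A ∣A∣≤0 =
    ∈-map⁺ (outside Vec.∷_) (supersets-complete O zero (drop-∷-⊆ O⊆A) ∣A∣≤0)
  supersets-complete (outside Vec.∷ O) (suc k) {inside Vec.∷ A} O⊆A (s≤s ∣A∣≤k) =
    ∈-++⁺ˡ (∈-map⁺ (inside Vec.∷_) (supersets-complete O k (drop-∷-⊆ O⊆A) ∣A∣≤k))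
  supersets-complete (outside Vec.∷ O) (suc k) {outside Vec.∷ A} O⊆A ∣A∣≤k =
    ∈-++⁺ʳ (map (inside Vec.∷_) (value (supersets O k)))
      (∈-map⁺ (outside Vec.∷_) (supersets-complete O (suc k) (drop-∷-⊆ O⊆A) ∣A∣≤k))

  -- The left side unfolds to `(2 + m) * (1 + m) ^ k`. Its summands are the two branches on a
  -- machine: taking it uses one unit of the size budget, skipping it uses none.
  ^-step : ∀ m k → (1 + m) ^ k + (1 + m) ^ suc k ≤ (2 + m) ^ suc k
  ^-step m k = ℕ.*-monoʳ-≤ (2 + m) (ℕ.^-monoˡ-≤ k (ℕ.n≤1+n (1 + m)))

  -- Induction on the machines: by `^-step`, `(1 + m) ^ k` dominates the branching recurrence. For
  -- fixed `k` the count is thus polynomial in `m`.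
  length-supersets : ∀ {m} (O : Subset m) k → length (value (supersets O k)) ≤ (1 + m) ^ k
  length-supersets {zero}  Vec.[] k = ℕ.≤-reflexive (sym (ℕ.^-zeroˡ k))
  length-supersets {suc m} (inside Vec.∷ O) zero = z≤n
  length-supersets {suc m} (inside Vec.∷ O) (suc k)
    rewrite List.length-map (inside Vec.∷_) (value (supersets O k)) =
    ℕ.≤-trans (length-supersets O k) (ℕ.m+n≤o⇒m≤o _ (^-step m k))
  length-supersets {suc m} (outside Vec.∷ O) zero
    rewrite List.length-map (outside Vec.∷_) (value (supersets O zero)) = length-supersets O zero
  length-supersets {suc m} (outside Vec.∷ O) (suc k)
    rewrite List.length-++ (map (inside Vec.∷_) (value (supersets O k))) {map (outside Vec.∷_) (value (supersets O (suc k)))}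
          | List.length-map (inside Vec.∷_) (value (supersets O k))
          | List.length-map (outside Vec.∷_) (value (supersets O (suc k))) =
    ℕ.≤-trans (ℕ.+-mono-≤ (length-supersets O k) (length-supersets O (suc k))) (^-step m k)

  -- sₐ and s_b are the costs of the two recursive calls, Lₐ and L_b the lengths of their results.
  branching-cost : ∀ m {a b sₐ s_b X Lₐ L_b} → Lₐ ≤ a → L_b ≤ b →
                   sₐ ≤ (1 + 3 * m) * a → s_b ≤ (1 + 3 * m) * b → a + b ≤ X → 1 ≤ X →
                   1 + (sₐ + (s_b + (Lₐ + (L_b + Lₐ)))) ≤ (1 + 3 * suc m) * X
  branching-cost m {a} {b} {sₐ} {s_b} {X} {Lₐ} {L_b} Lₐ≤ L_b≤ sₐ≤ s_b≤ a+b≤X 1≤X = begin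
    1 + (sₐ + (s_b + (Lₐ + (L_b + Lₐ))))
      ≤⟨ ℕ.+-mono-≤ 1≤X (ℕ.+-mono-≤ sₐ≤ (ℕ.+-mono-≤ s_b≤ (ℕ.+-mono-≤ Lₐ≤ (ℕ.+-mono-≤ L_b≤ (ℕ.≤-trans Lₐ≤ (ℕ.m+n≤o⇒m≤o a a+b≤X)))))) ⟩
    X + (c * a + (c * b + (a + (b + X))))
      ≡⟨ solve 4 (λ c a b X → X :+ (c :* a :+ (c :* b :+ (a :+ (b :+ X)))) := c :* (a :+ b) :+ ((a :+ b) :+ (X :+ X))) refl c a b X ⟩
    c * (a + b) + ((a + b) + (X + X))     ≤⟨ ℕ.+-mono-≤ (ℕ.*-monoʳ-≤ c a+b≤X) (ℕ.+-monoˡ-≤ (X + X) a+b≤X) ⟩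
    c * X + (X + (X + X))
      ≡⟨ solve 2 (λ m X → (con 1 :+ con 3 :* m) :* X :+ (X :+ (X :+ X)) := (con 1 :+ con 3 :* (con 1 :+ m)) :* X) refl m X ⟩
    (1 + 3 * suc m) * X                   ∎
    where
    open ℕ.≤-Reasoning
    open ℕS
    c = 1 + 3 * m

  -- Each machine adds at most three times the bound on the result: one share for the tick, one for
  -- mapping over both sublists, one for the append. The tick at the base is the 1 in `1 + 3 * m`.
  steps-supersets : ∀ {m} (O : Subset m) k → steps (supersets O k) ≤ (1 + 3 * m) * (1 + m) ^ k
  steps-supersets {zero} Vec.[] k = ℕ.≤-reflexive (sym (trans (ℕ.+-identityʳ _) (ℕ.^-zeroˡ k)))
  steps-supersets {suc m} (inside Vec.∷ O) zero = s≤s z≤n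
  steps-supersets {suc m} (inside Vec.∷ O) (suc k) = ℕ.≤-trans
    -- The cost of the single recursive call is padded to the shape of `branching-cost` with a free
    -- and empty second branch.
    (s≤s (ℕ.+-monoʳ-≤ (steps (supersets O k)) (ℕ.m≤m+n _ _)))
    (branching-cost m (length-supersets O k) z≤n (steps-supersets O k) z≤n (^-step m k) (ℕ.m^n>0 (2 + m) (suc k)))
  steps-supersets {suc m} (outside Vec.∷ O) zero = ℕ.≤-trans
    (s≤s (ℕ.+-monoʳ-≤ (steps (supersets O zero)) (ℕ.m≤m+n _ _)))
    (branching-cost m (length-supersets O zero) z≤n (steps-supersets O zero) z≤n (s≤s (z≤n {0})) (s≤s z≤n))
  steps-supersets {suc m} (outside Vec.∷ O) (suc k)
    rewrite List.length-map (inside Vec.∷_) (value (supersets O k)) =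
    branching-cost m (length-supersets O k) (length-supersets O (suc k)) (steps-supersets O k) (steps-supersets O (suc k))
      (^-step m k) (ℕ.m^n>0 (2 + m) (suc k))

  -- Search for the first success

  module _ {X Y : Set} (f : X → Timed (Maybe Y)) where

    firstSuccess-just : ∀ xs {y} → value (firstSuccess f xs) ≡ just y → ∃[ x ] x List.∈ xs × value (f x) ≡ just y
    firstSuccess-just (x ∷ xs) eq with value (f x) in fx
    firstSuccess-just (x ∷ xs) refl | just y  = x , here refl , fx
    firstSuccess-just (x ∷ xs) eq   | nothing = Product.map₂ (Product.map₁ there) (firstSuccess-just xs eq)

    firstSuccess-nothing : ∀ xs → value (firstSuccess f xs) ≡ nothing → ∀ {x} → x List.∈ xs → value (f x) ≡ nothing
    firstSuccess-nothing (x ∷ xs) eq x∈ with value (f x) in fx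
    firstSuccess-nothing (x ∷ xs) eq (here refl) | nothing = fx
    firstSuccess-nothing (x ∷ xs) eq (there x∈)  | nothing = firstSuccess-nothing xs eq x∈

    -- The bound is asked of members only, because the speed of the fixed-set procedure is
    -- guaranteed only for sets containing `O(T)`.
    steps-firstSuccess : ∀ {K} xs → (∀ {x} → x List.∈ xs → steps (f x) ≤ K) → steps (firstSuccess f xs) ≤ length xs * (1 + K)
    steps-firstSuccess [] f≤K = z≤n
    steps-firstSuccess {K} (x ∷ xs) f≤K with value (f x)
    ... | just _  = s≤s (ℕ.+-mono-≤ (f≤K (here refl)) z≤n)
    ... | nothing = s≤s (ℕ.+-mono-≤ (f≤K (here refl)) (steps-firstSuccess xs (λ x∈ → f≤K (there x∈))))

  -- Z = n m D H absorbs every summand of the cost of one round of the loop.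
  round-cost≤ : ∀ f {n m} D H → 1 ≤ n → 1 ≤ m → 1 ≤ D → 1 ≤ H →
    1 + (n * m + m + (m + ((1 + 3 * m) * D + D * (1 + f * (n * m * H))))) ≤ (9 + f) * (n * m * (D * H))
  round-cost≤ f {n} {m} D H 1≤n 1≤m 1≤D 1≤H = begin
    1 + (n * m + m + (m + ((1 + 3 * m) * D + D * (1 + f * (n * m * H)))))
      ≡⟨ solve 5 (λ f n m D H → con 1 :+ (n :* m :+ m :+ (m :+ ((con 1 :+ con 3 :* m) :* D :+ D :* (con 1 :+ f :* (n :* m :* H)))))
           := con 1 :+ (n :* m :+ (con 2 :* m :+ (con 3 :* (m :* D) :+ (con 2 :* D :+ f :* (n :* m :* (D :* H))))))) refl f n m D H ⟩
    1 + (n * m + (2 * m + (3 * (m * D) + (2 * D + f * Z))))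
      ≤⟨ ℕ.+-mono-≤ (ℕ.≤-trans 1≤D D≤Z) (ℕ.+-mono-≤ nm≤Z (ℕ.+-mono-≤ (ℕ.*-monoʳ-≤ 2 m≤Z)
           (ℕ.+-mono-≤ (ℕ.*-monoʳ-≤ 3 mD≤Z) (ℕ.+-monoˡ-≤ (f * Z) (ℕ.*-monoʳ-≤ 2 D≤Z))))) ⟩
    Z + (Z + (2 * Z + (3 * Z + (2 * Z + f * Z))))
      ≡⟨ solve 2 (λ f Z → Z :+ (Z :+ (con 2 :* Z :+ (con 3 :* Z :+ (con 2 :* Z :+ f :* Z)))) := (con 9 :+ f) :* Z) refl f Z ⟩
    (9 + f) * Z ∎
    where
    open ℕ.≤-Reasoning
    open ℕS
    Z = n * m * (D * H)
    ≤*ˡ : ∀ {a} b → 1 ≤ a → b ≤ a * b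
    ≤*ˡ {a} b 1≤a = ℕ.m≤n*m b a {{ℕ.>-nonZero 1≤a}}
    ≤*ʳ : ∀ a {b} → 1 ≤ b → a ≤ a * b
    ≤*ʳ a {b} 1≤b = ℕ.m≤m*n a b {{ℕ.>-nonZero 1≤b}}
    mD≤Z : m * D ≤ Z
    mD≤Z = ℕ.*-mono-≤ (≤*ˡ m 1≤n) (≤*ʳ D 1≤H)
    D≤Z : D ≤ Z
    D≤Z = ℕ.≤-trans (≤*ˡ D 1≤m) mD≤Z
    m≤Z : m ≤ Z
    m≤Z = ℕ.≤-trans (≤*ʳ m 1≤D) mD≤Z
    nm≤Z : n * m ≤ Z
    nm≤Z = ≤*ʳ (n * m) (ℕ.*-mono-≤ 1≤D 1≤H)

  -- As 2 ≤ m, the factors E, m and (1 + m)^(4E) are at most m^E, m^E and m^(8E).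
  total-cost≤ : ∀ f {n m E} H → 1 ≤ n → 2 ≤ m → 1 ≤ E → 1 ≤ H →
    n + m + n * (2 + m) + (n * m + m) + E * ((9 + f) * (n * m * ((1 + m) ^ (4 * E) * H))) ≤
    (16 + f) * (n * m ^ (10 * E)) * H
  total-cost≤ f {n} {m@(suc _)} {E} H 1≤n 2≤m 1≤E 1≤H = begin
    n + m + n * (2 + m) + (n * m + m) + E * ((9 + f) * Z)
      ≡⟨ solve 5 (λ f n m E Z → n :+ m :+ n :* (con 2 :+ m) :+ (n :* m :+ m) :+ E :* ((con 9 :+ f) :* Z)
           := con 3 :* n :+ (con 2 :* m :+ (con 2 :* (n :* m) :+ (con 9 :+ f) :* (E :* Z)))) refl f n m E Z ⟩
    3 * n + (2 * m + (2 * (n * m) + (9 + f) * (E * Z)))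
      ≤⟨ ℕ.+-mono-≤ (ℕ.*-monoʳ-≤ 3 (ℕ.≤-trans (ℕ.m≤m*n n m) nm≤EZ))
           (ℕ.+-mono-≤ (ℕ.*-monoʳ-≤ 2 (ℕ.≤-trans (ℕ.m≤n*m m n {{ℕ.>-nonZero 1≤n}}) nm≤EZ))
             (ℕ.+-monoˡ-≤ ((9 + f) * (E * Z)) (ℕ.*-monoʳ-≤ 2 nm≤EZ))) ⟩
    3 * (E * Z) + (2 * (E * Z) + (2 * (E * Z) + (9 + f) * (E * Z)))
      ≡⟨ solve 2 (λ f Z → con 3 :* Z :+ (con 2 :* Z :+ (con 2 :* Z :+ (con 9 :+ f) :* Z)) := (con 16 :+ f) :* Z) refl f (E * Z) ⟩
    (16 + f) * (E * Z)
      ≤⟨ ℕ.*-monoʳ-≤ (16 + f) EZ≤ ⟩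
    (16 + f) * (n * m ^ (10 * E) * H)
      ≡⟨ ℕ.*-assoc (16 + f) (n * m ^ (10 * E)) H ⟨
    (16 + f) * (n * m ^ (10 * E)) * H ∎
    where
    open ℕ.≤-Reasoning
    open ℕS
    D = (1 + m) ^ (4 * E)
    Z = n * m * (D * H)
    nm≤EZ : n * m ≤ E * Z
    nm≤EZ = ℕ.≤-trans (ℕ.m≤m*n (n * m) (D * H) {{ℕ.>-nonZero (ℕ.*-mono-≤ (ℕ.m^n>0 (1 + m) (4 * E)) 1≤H)}})
      (ℕ.m≤n*m Z E {{ℕ.>-nonZero 1≤E}})
    k<m^k : ∀ k → k < m ^ k
    k<m^k zero    = s≤s z≤n
    k<m^k (suc k) = ℕ.≤-trans (ℕ.+-mono-≤ (ℕ.m^n>0 m k) (k<m^k k))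
      (ℕ.≤-trans (ℕ.≤-reflexive (cong (m ^ k +_) (sym (ℕ.+-identityʳ (m ^ k))))) (ℕ.*-monoˡ-≤ (m ^ k) 2≤m))
    m≤m^E : m ≤ m ^ E
    m≤m^E = subst (_≤ m ^ E) (ℕ.*-identityʳ m) (ℕ.^-monoʳ-≤ m 1≤E)
    D≤ : D ≤ m ^ (2 * (4 * E))
    D≤ = subst (D ≤_) (ℕ.^-*-assoc m 2 (4 * E)) (ℕ.^-monoˡ-≤ (4 * E) (begin
      1 + m     ≤⟨ ℕ.+-monoˡ-≤ m (s≤s (z≤n {ℕ.pred m})) ⟩
      m + m     ≡⟨ cong (m +_) (ℕ.+-identityʳ m) ⟨
      2 * m     ≤⟨ ℕ.*-mono-≤ 2≤m (ℕ.≤-reflexive (sym (ℕ.*-identityʳ m))) ⟩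
      m ^ 2     ∎))
    EZ≤ : E * Z ≤ n * m ^ (10 * E) * H
    EZ≤ = begin
      E * (n * m * (D * H))                                ≤⟨ ℕ.*-mono-≤ (ℕ.<⇒≤ (k<m^k E)) (ℕ.*-mono-≤ (ℕ.*-monoʳ-≤ n m≤m^E) (ℕ.*-monoˡ-≤ H D≤)) ⟩
      m ^ E * (n * m ^ E * (m ^ (2 * (4 * E)) * H))
        ≡⟨ solve 4 (λ a n b H → a :* (n :* a :* (b :* H)) := n :* (a :* (a :* b)) :* H) refl (m ^ E) n (m ^ (2 * (4 * E))) H ⟩
      n * (m ^ E * (m ^ E * m ^ (2 * (4 * E)))) * H        ≡⟨ cong (λ z → n * (m ^ E * z) * H) (ℕ.^-distribˡ-+-* m E (2 * (4 * E))) ⟨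
      n * (m ^ E * m ^ (E + 2 * (4 * E))) * H              ≡⟨ cong (λ z → n * z * H) (ℕ.^-distribˡ-+-* m E (E + 2 * (4 * E))) ⟨
      n * m ^ (E + (E + 2 * (4 * E))) * H
        ≡⟨ cong (λ z → n * m ^ z * H) (solve 1 (λ E → E :+ (E :+ con 2 :* (con 4 :* E)) := con 10 :* E) refl E) ⟩
      n * m ^ (10 * E) * H                                 ∎

-- Rational bounds

open import Data.Rational.Base using (_<_; _≤_; _+_; _*_)

-- The gcd normalisation in `z / 1` does not compute for a variable `z`. Rewriting to this normal
-- form exposes the numerator, so that order and arithmetic reduce to the integers.
/1-normal : ∀ z → z ℚ./ 1 ≡ ℚ.mkℚ z 0 (Coprime.sym (Coprime.1-coprimeTo ℤ.∣ z ∣))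
/1-normal z = ℚ.fromℚᵘ-toℚᵘ (ℚ.mkℚ z 0 _)

/1-mono-≤ : ∀ {i j} → i ℤ.≤ j → i ℚ./ 1 ≤ j ℚ./ 1
/1-mono-≤ {i} {j} i≤j rewrite /1-normal i | /1-normal j = ℚ.*≤* (ℤ.*-monoʳ-≤-nonNeg (ℤ.+ 1) i≤j)

/1-cancel-≤ : ∀ {i j} → i ℚ./ 1 ≤ j ℚ./ 1 → i ℤ.≤ j
/1-cancel-≤ {i} {j} h rewrite /1-normal i | /1-normal j = ℤ.*-cancelʳ-≤-pos i j (ℤ.+ 1) (ℚ.drop-*≤* h)

/1-homo-+ : ∀ i j → (i ℤ.+ j) ℚ./ 1 ≡ i ℚ./ 1 + j ℚ./ 1
/1-homo-+ i j = trans
  (cong (ℚ._/ 1) (sym (cong₂ ℤ._+_ (ℤ.*-identityʳ i) (ℤ.*-identityʳ j))))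
  (sym (cong₂ _+_ (/1-normal i) (/1-normal j)))

/1-homo-* : ∀ i j → (i ℤ.* j) ℚ./ 1 ≡ (i ℚ./ 1) * (j ℚ./ 1)
/1-homo-* i j = sym (cong₂ _*_ (/1-normal i) (/1-normal j))

⟦⟧-mono : ∀ {a b} → a ℕ.≤ b → ⟦ a ⟧ ≤ ⟦ b ⟧
⟦⟧-mono a≤b = /1-mono-≤ (ℤ.+≤+ a≤b)

⟦⟧-+ : ∀ a b → ⟦ a ℕ.+ b ⟧ ≡ ⟦ a ⟧ + ⟦ b ⟧
⟦⟧-+ a b = /1-homo-+ (ℤ.+ a) (ℤ.+ b)

⟦⟧-* : ∀ a b → ⟦ a ℕ.* b ⟧ ≡ ⟦ a ⟧ * ⟦ b ⟧
⟦⟧-* a b = trans (cong (ℚ._/ 1) (ℤ.pos-* a b)) (/1-homo-* (ℤ.+ a) (ℤ.+ b))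

⟦⟧-^ : ∀ a k → ⟦ a ℕ.^ k ⟧ ≡ ⟦ a ⟧ ^ℚ k
⟦⟧-^ a zero    = refl
⟦⟧-^ a (suc k) = trans (⟦⟧-* a (a ℕ.^ k)) (cong (⟦ a ⟧ *_) (⟦⟧-^ a k))

0≤⟦_⟧ : ∀ a → 0ℚ ≤ ⟦ a ⟧
0≤⟦ a ⟧ = ⟦⟧-mono {0} {a} ℕ.z≤n

*-monoʳ : ∀ {p q} r → 0ℚ ≤ r → p ≤ q → p * r ≤ q * r
*-monoʳ r 0≤r = ℚ.*-monoʳ-≤-nonNeg r {{ℚ.nonNegative 0≤r}}

*-monoˡ : ∀ {p q} r → 0ℚ ≤ r → p ≤ q → r * p ≤ r * q
*-monoˡ r 0≤r = ℚ.*-monoˡ-≤-nonNeg r {{ℚ.nonNegative 0≤r}}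

*-mono : ∀ {p q r s} → 0ℚ ≤ p → p ≤ q → 0ℚ ≤ r → r ≤ s → p * r ≤ q * s
*-mono {p} {q} {r} {s} 0≤p p≤q 0≤r r≤s =
  ℚ.≤-trans (*-monoʳ r 0≤r p≤q) (*-monoˡ q (ℚ.≤-trans 0≤p p≤q) r≤s)

*-nonNeg : ∀ {p q} → 0ℚ ≤ p → 0ℚ ≤ q → 0ℚ ≤ p * q
*-nonNeg 0≤p 0≤q = *-mono {0ℚ} {_} {0ℚ} ℚ.≤-refl 0≤p ℚ.≤-refl 0≤q

^ℚ-nonNeg : ∀ {p} k → 0ℚ ≤ p → 0ℚ ≤ p ^ℚ k
^ℚ-nonNeg zero    0≤p = 0≤⟦ 1 ⟧
^ℚ-nonNeg (suc k) 0≤p = *-nonNeg 0≤p (^ℚ-nonNeg k 0≤p)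

^ℚ-mono : ∀ {p q} k → 0ℚ ≤ p → p ≤ q → p ^ℚ k ≤ q ^ℚ k
^ℚ-mono zero    0≤p p≤q = ℚ.≤-refl
^ℚ-mono (suc k) 0≤p p≤q = *-mono 0≤p p≤q (^ℚ-nonNeg k 0≤p) (^ℚ-mono k 0≤p p≤q)

-- Applied with `c = 2 ^ 6` and `d = m ^ 6`, it turns a constant raised to the power `k` into a
-- power of `m`.
⟦⟧-^-mono : ∀ {a c d x} → 0ℚ ≤ x → c ℕ.≤ d → ⟦ a ⟧ ≤ ⟦ c ⟧ * x ^ℚ 2 →
            ∀ k → ⟦ a ℕ.^ k ⟧ ≤ ⟦ d ℕ.^ k ⟧ * x ^ℚ (2 ℕ.* k)
⟦⟧-^-mono {a} {c} {d} {x} 0≤x c≤d a≤ k = begin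
  ⟦ a ℕ.^ k ⟧                    ≡⟨ ⟦⟧-^ a k ⟩
  ⟦ a ⟧ ^ℚ k                     ≤⟨ ^ℚ-mono k 0≤⟦ a ⟧ a≤ ⟩
  (⟦ c ⟧ * x ^ℚ 2) ^ℚ k          ≡⟨ ℚ^.^-distrib-* ⟦ c ⟧ (x ^ℚ 2) k ⟩
  ⟦ c ⟧ ^ℚ k * (x ^ℚ 2) ^ℚ k     ≡⟨ cong₂ _*_ (sym (⟦⟧-^ c k)) (ℚ^.^-assocʳ x 2 k) ⟩
  ⟦ c ℕ.^ k ⟧ * x ^ℚ (2 ℕ.* k)   ≤⟨ *-monoʳ (x ^ℚ (2 ℕ.* k)) (^ℚ-nonNeg (2 ℕ.* k) 0≤x) (⟦⟧-mono (ℕ.^-monoˡ-≤ k c≤d)) ⟩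
  ⟦ d ℕ.^ k ⟧ * x ^ℚ (2 ℕ.* k)   ∎
  where open ℚ.≤-Reasoning

-- Floors and ceilings

neg-involutive : ∀ p → ℚ.- (ℚ.- p) ≡ p
neg-involutive = ℚS.solve 1 (λ p → ℚS.:- (ℚS.:- p) ℚS.:= p) refl

/1-homo‿- : ∀ i → (ℤ.- i) ℚ./ 1 ≡ ℚ.- (i ℚ./ 1)
/1-homo‿- (ℤ.+ zero)  = refl
/1-homo‿- ℤ.+[1+ n ]  = refl
/1-homo‿- ℤ.-[1+ n ]  = sym (neg-involutive (ℤ.+ suc n ℚ./ 1))

⌊p⌋≤p : ∀ p → ℚ.floor p ℚ./ 1 ≤ p
⌊p⌋≤p p@record{} rewrite /1-normal (ℚ.floor p) = ℚ.*≤* (begin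
  ℚ.floor p ℤ.* ℚ.↧ p ≤⟨ ℤ.[n/d]*d≤n (ℚ.↥ p) (ℚ.↧ p) ⟩
  ℚ.↥ p               ≡⟨ ℤ.*-identityʳ (ℚ.↥ p) ⟨
  ℚ.↥ p ℤ.* ℤ.+ 1     ∎)
  where open ℤ.≤-Reasoning

-- The remainder in the division that defines `floor` is strictly smaller than the denominator.
p<⌊p⌋+1 : ∀ p → p < ℚ.floor p ℚ./ 1 + 1ℚ
p<⌊p⌋+1 p@record{} = ℚ.<-≤-trans (subst (p <_) (sym (/1-normal (ℤ.suc (ℚ.floor p)))) (ℚ.*<* (begin-strict
  ℚ.↥ p ℤ.* ℤ.+ 1                 ≡⟨ ℤ.*-identityʳ (ℚ.↥ p) ⟩
  ℚ.↥ p                           <⟨ ℤ.n<s[n/ℕd]*d (ℚ.↥ p) (ℚ.↧ₙ p) ⟩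
  ℤ.suc (ℚ.↥ p ℤ./ℕ ℚ.↧ₙ p) ℤ.* ℚ.↧ p ≡⟨ cong (λ z → ℤ.suc z ℤ.* ℚ.↧ p) (ℤ.div-pos-is-/ℕ (ℚ.↥ p) (ℚ.↧ₙ p)) ⟨
  ℤ.suc (ℚ.floor p) ℤ.* ℚ.↧ p     ∎)))
  (ℚ.≤-reflexive (trans (/1-homo-+ (ℤ.+ 1) (ℚ.floor p)) (ℚ.+-comm 1ℚ (ℚ.floor p ℚ./ 1))))
  where open ℤ.≤-Reasoning

⌈⌉/1 : ∀ p → ℚ.ceiling p ℚ./ 1 ≡ ℚ.- (ℚ.floor (ℚ.- p) ℚ./ 1)
⌈⌉/1 p@record{} = /1-homo‿- (ℚ.floor (ℚ.- p))

p≤⌈p⌉ : ∀ p → p ≤ ℚ.ceiling p ℚ./ 1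
p≤⌈p⌉ p = begin
  p                                 ≡⟨ neg-involutive p ⟨
  ℚ.- ℚ.- p                         ≤⟨ ℚ.neg-antimono-≤ (⌊p⌋≤p (ℚ.- p)) ⟩
  ℚ.- (ℚ.floor (ℚ.- p) ℚ./ 1)       ≡⟨ ⌈⌉/1 p ⟨
  ℚ.ceiling p ℚ./ 1                 ∎
  where open ℚ.≤-Reasoning

⌈p⌉<p+1 : ∀ p → ℚ.ceiling p ℚ./ 1 < p + 1ℚ
⌈p⌉<p+1 p = begin-strict
  ℚ.ceiling p ℚ./ 1        ≡⟨ ⌈⌉/1 p ⟩
  ℚ.- f                    ≡⟨ solve 1 (λ f → :- f := :- (f :+ con 1ℚ) :+ con 1ℚ) refl f ⟩
  ℚ.- (f + 1ℚ) + 1ℚ        <⟨ ℚ.+-monoˡ-< 1ℚ (ℚ.neg-antimono-< (p<⌊p⌋+1 (ℚ.- p))) ⟩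
  ℚ.- ℚ.- p + 1ℚ           ≡⟨ cong (_+ 1ℚ) (neg-involutive p) ⟩
  p + 1ℚ                   ∎
  where
  open ℚ.≤-Reasoning
  open ℚS using (solve; _:+_; :-_; _:=_; con)
  f = ℚ.floor (ℚ.- p) ℚ./ 1

-- If `z` were below the ceiling, integrality would give `z + 1 ≤ ⌈p⌉ < p + 1 ≤ z + 1`.
⌈⌉-least : ∀ {p z} → p ≤ z ℚ./ 1 → ℚ.ceiling p ℤ.≤ z
⌈⌉-least {p} {z} p≤z = ℤ.≮⇒≥ λ z<⌈p⌉ → ℚ.<-irrefl refl (begin-strict
  ℚ.ceiling p ℚ./ 1    <⟨ ⌈p⌉<p+1 p ⟩
  p + 1ℚ               ≤⟨ ℚ.+-monoˡ-≤ 1ℚ p≤z ⟩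
  z ℚ./ 1 + 1ℚ         ≡⟨ /1-homo-+ z (ℤ.+ 1) ⟨
  (z ℤ.+ ℤ.+ 1) ℚ./ 1  ≤⟨ /1-mono-≤ (subst (ℤ._≤ ℚ.ceiling p) (ℤ.+-comm (ℤ.+ 1) z) (ℤ.i<j⇒suc[i]≤j z<⌈p⌉)) ⟩
  ℚ.ceiling p ℚ./ 1    ∎)
  where open ℚ.≤-Reasoning

-- The absolute value in `gridSize` is harmless, as the ceiling of a nonnegative number is
-- nonnegative.
+∣⌈⌉∣ : ∀ {p} → 0ℚ ≤ p → ℤ.+ ℤ.∣ ℚ.ceiling p ∣ ≡ ℚ.ceiling p
+∣⌈⌉∣ {p} 0≤p = ℤ.0≤i⇒+∣i∣≡i (/1-cancel-≤ (ℚ.≤-trans 0≤p (p≤⌈p⌉ p)))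

∣⌈⌉∣-mono : ∀ {p q} → 0ℚ ≤ p → p ≤ q → ℤ.∣ ℚ.ceiling p ∣ ℕ.≤ ℤ.∣ ℚ.ceiling q ∣
∣⌈⌉∣-mono {p} {q} 0≤p p≤q = ℤ.drop‿+≤+
  (subst₂ ℤ._≤_ (sym (+∣⌈⌉∣ 0≤p)) (sym (+∣⌈⌉∣ (ℚ.≤-trans 0≤p p≤q)))
    (⌈⌉-least (ℚ.≤-trans p≤q (p≤⌈p⌉ q))))

∣⌈p⌉∣≤p+1 : ∀ {p} → 0ℚ ≤ p → ⟦ ℤ.∣ ℚ.ceiling p ∣ ⟧ ≤ p + 1ℚ
∣⌈p⌉∣≤p+1 {p} 0≤p = ℚ.≤-trans (ℚ.≤-reflexive (cong (ℚ._/ 1) (+∣⌈⌉∣ 0≤p))) (ℚ.<⇒≤ (⌈p⌉<p+1 p))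

-- Width of the dynamic-programming grid in terms of E / ε

module _ (ε : ℚ) .{{_ : Positive ε}} where

  ε⁻¹ : ℚ
  ε⁻¹ = (ℚ.1/ ε) {{ℚ.pos⇒nonZero ε}}

  0≤ε⁻¹ : 0ℚ ≤ ε⁻¹
  0≤ε⁻¹ = ℚ.<⇒≤ (ℚ.positive⁻¹ ε⁻¹ {{ℚ.1/pos⇒pos ε}})

  1≤ε⁻¹ : ε < 1ℚ → 1ℚ ≤ ε⁻¹
  1≤ε⁻¹ ε<1 = begin
    1ℚ        ≡⟨ ℚ.*-inverseʳ ε {{ℚ.pos⇒nonZero ε}} ⟨
    ε * ε⁻¹   ≤⟨ *-monoʳ ε⁻¹ 0≤ε⁻¹ (ℚ.<⇒≤ ε<1) ⟩
    1ℚ * ε⁻¹  ≡⟨ ℚ.*-identityˡ ε⁻¹ ⟩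
    ε⁻¹       ∎
    where open ℚ.≤-Reasoning

  -- Lets the grid of every round be replaced by the one for `2 * E`, the largest `M` allowed.
  gridSize-mono : ∀ {M N} → M ℕ.≤ N → gridSize M ε ℕ.≤ gridSize N ε
  gridSize-mono {M} {N} M≤N = ∣⌈⌉∣-mono (*-nonNeg 0≤⟦ 3 ℕ.* M ℕ.^ 2 ⟧ 0≤ε⁻¹)
    (*-monoʳ ε⁻¹ 0≤ε⁻¹
      (⟦⟧-mono (ℕ.*-monoʳ-≤ 3 (ℕ.^-monoˡ-≤ 2 M≤N))))

  -- 2 ⌈12 E² / ε⌉ + 1 ≤ 24 E² / ε + 3 ≤ 27 (E / ε)², since 1 ≤ E and 1 ≤ 1 / ε.
  gridWidth≤ : ε < 1ℚ → ∀ {E} → 1 ℕ.≤ E →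
               ⟦ 2 ℕ.* gridSize (2 ℕ.* E) ε ℕ.+ 1 ⟧ ≤ ⟦ 64 ⟧ * (⟦ E ⟧ /ℚ ε) ^ℚ 2
  gridWidth≤ ε<1 {E} 1≤E = begin
    ⟦ 2 ℕ.* B ℕ.+ 1 ⟧
      ≡⟨ trans (⟦⟧-+ (2 ℕ.* B) 1) (cong (_+ 1ℚ) (⟦⟧-* 2 B)) ⟩
    ⟦ 2 ⟧ * ⟦ B ⟧ + 1ℚ
      ≤⟨ ℚ.+-monoˡ-≤ 1ℚ (ℚ.*-monoˡ-≤-nonNeg ⟦ 2 ⟧ (∣⌈p⌉∣≤p+1 (*-nonNeg 0≤⟦ 3 ℕ.* (2 ℕ.* E) ℕ.^ 2 ⟧ 0≤ε⁻¹))) ⟩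
    ⟦ 2 ⟧ * (⟦ 3 ℕ.* (2 ℕ.* E) ℕ.^ 2 ⟧ * y + 1ℚ) + 1ℚ
      ≡⟨ cong (λ z → ⟦ 2 ⟧ * (z * y + 1ℚ) + 1ℚ) e≡ ⟩
    ⟦ 2 ⟧ * (⟦ 12 ⟧ * (e * e) * y + 1ℚ) + 1ℚ
      ≡⟨ solve 2 (λ e y → con ⟦ 2 ⟧ :* (con ⟦ 12 ⟧ :* (e :* e) :* y :+ con 1ℚ) :+ con 1ℚ
         := con ⟦ 24 ⟧ :* (e :* e :* y) :+ con ⟦ 3 ⟧) refl e y ⟩
    -- The factor `1ℚ` is written out so that `1 ≤ e² y²` can merge the constant with the leading
    -- term.
    ⟦ 24 ⟧ * (e * e * y) + ⟦ 3 ⟧ * 1ℚ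
      ≤⟨ ℚ.+-mono-≤ (ℚ.*-monoˡ-≤-nonNeg ⟦ 24 ⟧ e²y≤) (ℚ.*-monoˡ-≤-nonNeg ⟦ 3 ⟧ (ℚ.≤-trans 1≤e²y e²y≤)) ⟩
    ⟦ 24 ⟧ * (e * e * (y * y)) + ⟦ 3 ⟧ * (e * e * (y * y))
      ≡⟨ solve 2 (λ e y → con ⟦ 24 ⟧ :* (e :* e :* (y :* y)) :+ con ⟦ 3 ⟧ :* (e :* e :* (y :* y))
         := con ⟦ 27 ⟧ :* (e :* y :* (e :* y :* con 1ℚ))) refl e y ⟩
    ⟦ 27 ⟧ * (e * y) ^ℚ 2
      -- 27 is rounded up to 64 = 2 ^ 6, which `2 ≤ m` later turns into `m ^ 6`.
      ≤⟨ *-monoʳ ((e * y) ^ℚ 2) (^ℚ-nonNeg 2 (*-nonNeg 0≤⟦ E ⟧ 0≤ε⁻¹)) (⟦⟧-mono {27} {64} (ℕ.m≤m+n 27 37)) ⟩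
    ⟦ 64 ⟧ * (e * y) ^ℚ 2           ∎
    where
    open ℚ.≤-Reasoning
    open ℚS using (solve; _:+_; _:*_; _:=_; con)
    e = ⟦ E ⟧
    y = ε⁻¹
    B = gridSize (2 ℕ.* E) ε
    e≡ : ⟦ 3 ℕ.* (2 ℕ.* E) ℕ.^ 2 ⟧ ≡ ⟦ 12 ⟧ * (e * e)
    e≡ = trans (cong ⟦_⟧ (ℕ-lemma E)) (trans (⟦⟧-* 12 (E ℕ.* E)) (cong (⟦ 12 ⟧ *_) (⟦⟧-* E E)))
      where
      ℕ-lemma : ∀ E → 3 ℕ.* (2 ℕ.* E) ℕ.^ 2 ≡ 12 ℕ.* (E ℕ.* E)
      ℕ-lemma = ℕS.solve 1 (λ E → ℕS.con 3 ℕS.:* (ℕS.con 2 ℕS.:* E) ℕS.:^ 2 ℕS.:= ℕS.con 12 ℕS.:* (E ℕS.:* E)) refl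
    1≤e : 1ℚ ≤ e
    1≤e = ⟦⟧-mono 1≤E
    1≤y : 1ℚ ≤ y
    1≤y = 1≤ε⁻¹ ε<1
    1≤e² : 1ℚ ≤ e * e
    1≤e² = *-mono 0≤⟦ 1 ⟧ 1≤e 0≤⟦ 1 ⟧ 1≤e
    0≤e² : 0ℚ ≤ e * e
    0≤e² = ℚ.≤-trans 0≤⟦ 1 ⟧ 1≤e²
    1≤e²y : 1ℚ ≤ e * e * y
    1≤e²y = *-mono 0≤⟦ 1 ⟧ 1≤e² 0≤⟦ 1 ⟧ 1≤y
    e²y≤ : e * e * y ≤ e * e * (y * y)
    e²y≤ = *-monoˡ (e * e) 0≤e²
      (ℚ.≤-trans (ℚ.≤-reflexive (sym (ℚ.*-identityʳ y))) (*-monoˡ y 0≤ε⁻¹ 1≤y))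

  gridWidth^≤ : ε < 1ℚ → ∀ {E} → 1 ℕ.≤ E → ∀ {m} → 2 ℕ.≤ m → ∀ k →
                ⟦ (2 ℕ.* gridSize (2 ℕ.* E) ε ℕ.+ 1) ℕ.^ k ⟧ ≤
                ⟦ m ℕ.^ (6 ℕ.* k) ⟧ * (⟦ E ⟧ /ℚ ε) ^ℚ (2 ℕ.* k)
  gridWidth^≤ ε<1 {E} 1≤E {m} 2≤m k =
    subst (λ c → ⟦ (2 ℕ.* gridSize (2 ℕ.* E) ε ℕ.+ 1) ℕ.^ k ⟧ ≤ ⟦ c ⟧ * (⟦ E ⟧ /ℚ ε) ^ℚ (2 ℕ.* k)) (ℕ.^-*-assoc m 6 k)
      (⟦⟧-^-mono (*-nonNeg 0≤⟦ E ⟧ 0≤ε⁻¹) (ℕ.^-monoˡ-≤ 6 2≤m) (gridWidth≤ ε<1 1≤E) k)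

  -- The grid width enters with exponent `4 * E` and contributes `m ^ 6` and the square of `E / ε`
  -- each time. Hence 34 = 10 + 6 · 4 and 8 = 2 · 4; `polylog 0` is 1.
  ℕ-bound⇒repairBound : ε < 1ℚ → ∀ C n {m E t} → 2 ℕ.≤ m → 1 ℕ.≤ E →
    t ℕ.≤ C ℕ.* (n ℕ.* m ℕ.^ (10 ℕ.* E)) ℕ.* (2 ℕ.* gridSize (2 ℕ.* E) ε ℕ.+ 1) ℕ.^ (4 ℕ.* E) →
    ⟦ t ⟧ ≤ ⟦ C ⟧ * repairBound 34 8 n m E ε * polylog 0 (repairBound 34 8 n m E ε)
  ℕ-bound⇒repairBound ε<1 C n {m} {E} {t} 2≤m 1≤E t≤ = begin
    ⟦ t ⟧                                            ≤⟨ ⟦⟧-mono t≤ ⟩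
    ⟦ C ℕ.* (n ℕ.* u) ℕ.* W ℕ.^ k ⟧                  ≡⟨ ⟦⟧-* (C ℕ.* (n ℕ.* u)) (W ℕ.^ k) ⟩
    ⟦ C ℕ.* (n ℕ.* u) ⟧ * ⟦ W ℕ.^ k ⟧                ≤⟨ *-monoˡ ⟦ C ℕ.* (n ℕ.* u) ⟧ 0≤⟦ C ℕ.* (n ℕ.* u) ⟧ (gridWidth^≤ ε<1 1≤E 2≤m k) ⟩
    ⟦ C ℕ.* (n ℕ.* u) ⟧ * (⟦ v ⟧ * X (2 ℕ.* k))      ≡⟨ cong (_* (⟦ v ⟧ * X (2 ℕ.* k))) (trans (⟦⟧-* C (n ℕ.* u)) (cong (⟦ C ⟧ *_) (⟦⟧-* n u))) ⟩
    ⟦ C ⟧ * (⟦ n ⟧ * ⟦ u ⟧) * (⟦ v ⟧ * X (2 ℕ.* k))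
      ≡⟨ solve 5 (λ c n u v x → c :* (n :* u) :* (v :* x) := c :* (n :* (u :* v) :* x)) refl ⟦ C ⟧ ⟦ n ⟧ ⟦ u ⟧ ⟦ v ⟧ (X (2 ℕ.* k)) ⟩
    ⟦ C ⟧ * (⟦ n ⟧ * (⟦ u ⟧ * ⟦ v ⟧) * X (2 ℕ.* k))  ≡⟨ cong₂ (λ p q → ⟦ C ⟧ * (⟦ n ⟧ * p * X q)) uv≡ (sym (ℕ.*-assoc 2 4 E)) ⟩
    ⟦ C ⟧ * repairBound 34 8 n m E ε                 ≡⟨ ℚ.*-identityʳ (⟦ C ⟧ * repairBound 34 8 n m E ε) ⟨
    ⟦ C ⟧ * repairBound 34 8 n m E ε * polylog 0 (repairBound 34 8 n m E ε) ∎
    where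
    open ℚ.≤-Reasoning
    open ℚS using (solve; _:*_; _:=_)
    W = 2 ℕ.* gridSize (2 ℕ.* E) ε ℕ.+ 1
    k = 4 ℕ.* E
    u = m ℕ.^ (10 ℕ.* E)
    v = m ℕ.^ (6 ℕ.* k)
    X : ℕ → ℚ
    X j = (⟦ E ⟧ /ℚ ε) ^ℚ j
    uv≡ : ⟦ u ⟧ * ⟦ v ⟧ ≡ ⟦ m ℕ.^ (34 ℕ.* E) ⟧
    uv≡ = trans (sym (⟦⟧-* u v)) (cong ⟦_⟧ (trans (sym (ℕ.^-distribˡ-+-* m (10 ℕ.* E) (6 ℕ.* k)))
      (cong (m ℕ.^_) (ℕS.solve 1 (λ E → ℕS.con 10 ℕS.:* E ℕS.:+ ℕS.con 6 ℕS.:* (ℕS.con 4 ℕS.:* E) ℕS.:= ℕS.con 34 ℕS.:* E) refl E))))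

-- The oracle and the loop

module _ {Y : Set} where

  -- These three lemmas handle the early exit of the oracle when `O(T)` has more than `2 * M`
  -- elements. A taken exit also yields `nothing`, so `unless-nothing` has to assume that the guard
  -- is false.
  unless-just : ∀ b (c : Timed (Maybe Y)) {y} → value (if b then return nothing else c) ≡ just y → value c ≡ just y
  unless-just false c eq = eq

  unless-nothing : ∀ {b} (c : Timed (Maybe Y)) → b ≡ false → value (if b then return nothing else c) ≡ nothing → value c ≡ nothing
  unless-nothing c refl eq = eq

  steps-unless : ∀ b (c : Timed (Maybe Y)) → steps (if b then return nothing else c) ℕ.≤ steps c
  steps-unless true  c = z≤n
  steps-unless false c = ℕ.≤-refl

module _ {n m : ℕ} (I : Instance n m) {T : ℚ} {σ̂ σ* : Assignment n m} where

  -- On such a machine the load under `σ*` is at most `T`, whereas the load under `σ̂` exceeds `T`.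
  overloaded⇒load-drops : ⟦ Cmax I σ* ⟧ ≤ T → ∀ {i} → i ∈ overloaded I T σ̂ → load I σ* i ℕ.< load I σ̂ i
  overloaded⇒load-drops C≤T {i} i∈O = ℕ.≰⇒> λ σ̂≤σ* → ℚ.<-irrefl refl (ℚ.<-≤-trans (∈-overloaded⁻ I i∈O)
    (ℚ.≤-trans (⟦⟧-mono (ℕ.≤-trans σ̂≤σ* (load≤Cmax I σ* i))) C≤T))

  overloaded⊆touched : ⟦ Cmax I σ* ⟧ ≤ T → overloaded I T σ̂ ⊆ touched σ* σ̂
  overloaded⊆touched C≤T i∈O =
    let j , σ̂j≡i , σ*j≢i = leaves-larger-load I (overloaded⇒load-drops C≤T i∈O)
    in subst (_∈ touched σ* σ̂) σ̂j≡i (∈-touchedʳ σ* σ̂ {j} (λ eq → σ*j≢i (trans eq σ̂j≡i)))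

  -- A moved job has both its machines in the set. So a job starting outside is unmoved, and one
  -- starting inside either stays or goes to a touched machine.
  touched-repair : ∀ {M} → Feasible I σ* → moveJobs σ* σ̂ ℕ.≤ M → LocalRepair I σ̂ M (touched σ* σ̂) σ*
  touched-repair feasible moves≤M = record
    { feasible = feasible
    ; outside≡ = λ j σ̂j∉A → decidable-stable (σ* j ≟ σ̂ j) (λ σ*j≢σ̂j → σ̂j∉A (∈-touchedʳ σ* σ̂ σ*j≢σ̂j))
    ; inside∈  = inside∈
    ; moves    = moves≤M
    }
    where
    inside∈ : ∀ j → σ̂ j ∈ touched σ* σ̂ → σ* j ∈ touched σ* σ̂
    inside∈ j σ̂j∈A with σ* j ≟ σ̂ j
    ... | yes σ*j≡σ̂j = subst (_∈ touched σ* σ̂) (sym σ*j≡σ̂j) σ̂j∈A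
    ... | no  σ*j≢σ̂j = ∈-touchedˡ σ* σ̂ σ*j≢σ̂j

inhabited⇒1≤n : ∀ {n} → Fin n → 1 ℕ.≤ n
inhabited⇒1≤n {suc n} _ = s≤s z≤n

distinct⇒2≤m : ∀ {m} {i k : Fin m} → i ≢ k → 2 ℕ.≤ m
distinct⇒2≤m {1} {zero} {zero} i≢k = contradiction refl i≢k
distinct⇒2≤m {suc (suc m)} _ = s≤s (s≤s z≤n)

module _ (P : FixedSetProcedure) {n m : ℕ} (I : Instance n m) (T ε : ℚ) .{{_ : Positive ε}}
         (ε<1 : ε < 1ℚ) {σ̂ : Assignment n m} (σ̂-feasible : Feasible I σ̂)
         (O-nonempty : Nonempty (overloaded I T σ̂)) where
  open FixedSetProcedure P

  Acceptable : Assignment n m → Set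
  Acceptable σ = Feasible I σ × ⟦ Cmax I σ ⟧ ≤ (1ℚ + ε) * T

  -- The procedure demands a nonempty `A`; this is inherited from `O(T)`, hence from Δ(T) > 0.
  guaranteed : ∀ {M A} → 1 ℕ.≤ M → overloaded I T σ̂ ⊆ A → Guarantee factor I T ε σ̂ M A (run I T ε σ̂ M A)
  guaranteed {M} {A} 1≤M O⊆A = guarantee I T ε ε<1 σ̂ σ̂-feasible M 1≤M A (Product.map₂ O⊆A O-nonempty) O⊆A

  oracle-sound : ∀ {M σ} → 1 ℕ.≤ M → value (globalRepairOracle P I T ε M σ̂) ≡ just σ → Acceptable σ
  oracle-sound {M} 1≤M eq =
    let A , A∈ , run≡just = firstSuccess-just (run I T ε σ̂ M) _ (unless-just (does (2 ℕ.* M ℕ.<? ∣ overloaded I T σ̂ ∣)) _ eq)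
        O⊆A , _ = supersets-sound (overloaded I T σ̂) (2 ℕ.* M) A∈
    in Product.map₁ LocalRepair.feasible (Guarantee.sound (guaranteed 1≤M O⊆A) run≡just)

  -- `O(T) ⊆ A` and the size of `A` rule out the early exit and put `A` into the enumeration, so a
  -- failing oracle would have failed on `A` itself.
  oracle-complete : ∀ {M A σ′} → 1 ℕ.≤ M → overloaded I T σ̂ ⊆ A → ∣ A ∣ ℕ.≤ 2 ℕ.* M →
                    LocalRepair I σ̂ M A σ′ → ⟦ Cmax I σ′ ⟧ ≤ T →
                    value (globalRepairOracle P I T ε M σ̂) ≢ nothing
  oracle-complete {M} 1≤M O⊆A ∣A∣≤2M repair C≤T eq =
    Guarantee.complete (guaranteed 1≤M O⊆A) repair C≤T
      (firstSuccess-nothing (run I T ε σ̂ M) _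
        (unless-nothing _ (dec-false (2 ℕ.* M ℕ.<? ∣ overloaded I T σ̂ ∣) (ℕ.≤⇒≯ (ℕ.≤-trans (p⊆q⇒∣p∣≤∣q∣ O⊆A) ∣A∣≤2M))) eq)
        (supersets-complete (overloaded I T σ̂) (2 ℕ.* M) O⊆A ∣A∣≤2M))

  -- `K` and `G` stand for `4 * E` and the grid width at `2 * E`, so that all rounds share one
  -- bound. `1 ≤ G` makes powers of `G` monotone in the exponent.
  steps-run : ∀ {M A K G} → 1 ℕ.≤ M → 2 ℕ.* M ℕ.≤ K → 2 ℕ.* gridSize M ε ℕ.+ 1 ℕ.≤ G → 1 ℕ.≤ G →
              overloaded I T σ̂ ⊆ A → ∣ A ∣ ℕ.≤ 2 ℕ.* M →
              steps (run I T ε σ̂ M A) ℕ.≤ factor ℕ.* (n ℕ.* m ℕ.* G ℕ.^ K)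
  steps-run {M} {A} {K} {G} 1≤M 2M≤K grid≤G 1≤G O⊆A ∣A∣≤2M = ℕ.≤-trans (Guarantee.fast (guaranteed 1≤M O⊆A))
    (ℕ.*-monoʳ-≤ factor (ℕ.*-mono-≤ (ℕ.*-mono-≤ length-jobs≤n (∣p∣≤n A)) (ℕ.≤-trans
      (ℕ.^-monoˡ-≤ (∣ A ∣ ℕ.∸ 1) grid≤G)
      (ℕ.^-monoʳ-≤ G {{ℕ.>-nonZero 1≤G}} (ℕ.≤-trans (ℕ.m∸n≤m ∣ A ∣ 1) (ℕ.≤-trans ∣A∣≤2M 2M≤K))))))
    where
    length-jobs≤n : length (jobsOn σ̂ A) ℕ.≤ n
    length-jobs≤n = ℕ.≤-trans (List.length-filter (λ j → σ̂ j ∈? A) (allFin n)) (ℕ.≤-reflexive (List.length-tabulate {n = n} id))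

  steps-oracle : ∀ {M K G} → 1 ℕ.≤ M → 2 ℕ.* M ℕ.≤ K → 2 ℕ.* gridSize M ε ℕ.+ 1 ℕ.≤ G → 1 ℕ.≤ G → 1 ℕ.≤ n → 1 ℕ.≤ m →
                 1 ℕ.+ steps (globalRepairOracle P I T ε M σ̂) ℕ.≤ (9 ℕ.+ factor) ℕ.* (n ℕ.* m ℕ.* ((1 ℕ.+ m) ℕ.^ K ℕ.* G ℕ.^ K))
  steps-oracle {M} {K} {G} 1≤M 2M≤K grid≤G 1≤G 1≤n 1≤m = ℕ.≤-trans
    (s≤s (ℕ.+-monoʳ-≤ (n ℕ.* m ℕ.+ m) (ℕ.+-monoʳ-≤ m (ℕ.≤-trans
      (steps-unless (does (2 ℕ.* M ℕ.<? ∣ overloaded I T σ̂ ∣)) (supersets (overloaded I T σ̂) (2 ℕ.* M) >>= firstSuccess (run I T ε σ̂ M)))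
      (ℕ.+-mono-≤
        (ℕ.≤-trans (steps-supersets (overloaded I T σ̂) (2 ℕ.* M)) (ℕ.*-monoʳ-≤ (1 ℕ.+ 3 ℕ.* m) D-mono))
        (ℕ.≤-trans (steps-firstSuccess (run I T ε σ̂ M) (value (supersets (overloaded I T σ̂) (2 ℕ.* M))) run≤)
          (ℕ.*-monoˡ-≤ (1 ℕ.+ factor ℕ.* (n ℕ.* m ℕ.* G ℕ.^ K)) (ℕ.≤-trans (length-supersets (overloaded I T σ̂) (2 ℕ.* M)) D-mono))))))))
    (round-cost≤ factor ((1 ℕ.+ m) ℕ.^ K) (G ℕ.^ K) 1≤n 1≤m (ℕ.m^n>0 (1 ℕ.+ m) K) (ℕ.m^n>0 G {{ℕ.>-nonZero 1≤G}} K))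
    where
    D-mono : (1 ℕ.+ m) ℕ.^ (2 ℕ.* M) ℕ.≤ (1 ℕ.+ m) ℕ.^ K
    D-mono = ℕ.^-monoʳ-≤ (1 ℕ.+ m) 2M≤K
    run≤ : ∀ {A} → A List.∈ value (supersets (overloaded I T σ̂) (2 ℕ.* M)) → steps (run I T ε σ̂ M A) ℕ.≤ factor ℕ.* (n ℕ.* m ℕ.* G ℕ.^ K)
    run≤ A∈ = let O⊆A , ∣A∣≤2M = supersets-sound (overloaded I T σ̂) (2 ℕ.* M) A∈
              in steps-run 1≤M 2M≤K grid≤G 1≤G O⊆A ∣A∣≤2M

  -- M stays below 2E because the oracle cannot fail once E ≤ M.
  repeat-terminates : ∀ {E K} →
    (∀ {M} → 1 ℕ.≤ M → E ℕ.≤ M → value (globalRepairOracle P I T ε M σ̂) ≢ nothing) →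
    (∀ {M} → 1 ℕ.≤ M → M ℕ.≤ 2 ℕ.* E → 1 ℕ.+ steps (globalRepairOracle P I T ε M σ̂) ℕ.≤ K) →
    ∀ fuel {M} → 1 ℕ.≤ M → M ℕ.≤ 2 ℕ.* E → E ℕ.≤ M ℕ.+ fuel →
    ∃[ σ ] ∃[ t ] Repeat P I T ε σ̂ M σ t × Acceptable σ × t ℕ.≤ suc fuel ℕ.* K
  repeat-terminates {E} {K} complete cheap fuel {M} 1≤M M≤2E E≤M+fuel =
    continue (value (globalRepairOracle P I T ε M σ̂)) refl fuel E≤M+fuel
    where
    continue : ∀ r → value (globalRepairOracle P I T ε M σ̂) ≡ r → ∀ fuel → E ℕ.≤ M ℕ.+ fuel →
               ∃[ σ ] ∃[ t ] Repeat P I T ε σ̂ M σ t × Acceptable σ × t ℕ.≤ suc fuel ℕ.* K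
    continue (just σ) eq fuel _ =
      σ , _ , found eq , oracle-sound 1≤M eq , ℕ.≤-trans (cheap 1≤M M≤2E) (ℕ.m≤m+n K (fuel ℕ.* K))
    continue nothing eq zero E≤M+0 = contradiction eq (complete 1≤M (subst (E ℕ.≤_) (ℕ.+-identityʳ M) E≤M+0))
    continue nothing eq (suc fuel) E≤M+fuel =
      let σ , t , rep , ok , t≤ = repeat-terminates complete cheap fuel
            (ℕ.≤-trans 1≤M (ℕ.m≤n*m M 2))
            (ℕ.*-monoʳ-≤ 2 (ℕ.<⇒≤ (ℕ.≰⇒> λ E≤M → complete 1≤M E≤M eq)))
            (ℕ.≤-trans E≤M+fuel (M+suc≤ fuel))
      in σ , _ , again eq rep , ok , ℕ.+-mono-≤ (cheap 1≤M M≤2E) t≤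
      where
      -- Doubling `M ≥ 1` adds at least one, which pays for the unit of fuel. Counting rounds
      -- linearly costs only a factor `E`, later absorbed by `m ^ E`.
      M+suc≤ : ∀ f → M ℕ.+ suc f ℕ.≤ 2 ℕ.* M ℕ.+ f
      M+suc≤ f = ℕ.≤-trans (ℕ.+-monoʳ-≤ M (ℕ.+-monoˡ-≤ f 1≤M))
        (ℕ.≤-reflexive (trans (sym (ℕ.+-assoc M M f)) (cong (λ z → M ℕ.+ z ℕ.+ f) (sym (ℕ.+-identityʳ M)))))

-- Application to an optimal schedule closest to the prediction

corollary30 : (P : FixedSetProcedure) →
    ∃[ a ] ∃[ b ] ∃[ c ] ∃[ k ]
    (∀ {n m : ℕ} (I : Instance n m) (π̂ : Assignment n m) (rule : ProjectRule n m)
    (T ε : ℚ) .{{_ : Positive ε}} → ε < 1ℚ →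
    (opt E : ℕ) → IsOPT I opt → IsMovedJobError I π̂ E →
    ⟦ opt ⟧ ≤ T →
    0ℚ < excess I T (value (project I rule π̂)) →
    ∃[ σ ] ∃[ t ]
    GlobalRepairJobs P I T ε rule π̂ σ t
    × Feasible I σ
    × ⟦ Cmax I σ ⟧ ≤ (1ℚ + ε) * T
    × ⟦ t ⟧ ≤ ⟦ c ⟧ * repairBound a b n m E ε * polylog k (repairBound a b n m E ε))
corollary30 P = 34 , 8 , 16 ℕ.+ factor , 0 , main
  where
  open FixedSetProcedure P using (factor)

  main : ∀ {n m : ℕ} (I : Instance n m) (π̂ : Assignment n m) (rule : ProjectRule n m)
         (T ε : ℚ) .{{_ : Positive ε}} → ε < 1ℚ →
         (opt E : ℕ) → IsOPT I opt → IsMovedJobError I π̂ E →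
         ⟦ opt ⟧ ≤ T →
         0ℚ < excess I T (value (project I rule π̂)) →
         ∃[ σ ] ∃[ t ]
         GlobalRepairJobs P I T ε rule π̂ σ t
         × Feasible I σ
         × ⟦ Cmax I σ ⟧ ≤ (1ℚ + ε) * T
         × ⟦ t ⟧ ≤ ⟦ 16 ℕ.+ factor ⟧ * repairBound 34 8 n m E ε * polylog 0 (repairBound 34 8 n m E ε)
  main {n} {m} I π̂ rule T ε ε<1 opt E isOPT isError opt≤T 0<Δ =
    let σ , t , rep , (feasible , C≤) , t≤ = repeat-terminates P I T ε ε<1 σ̂-feasible O-nonempty complete cheap
          -- Starting from `M = 1`, fuel `E ∸ 1` satisfies `E ≤ M + fuel` and allows at most `E`
          -- rounds.
          (E ℕ.∸ 1) ℕ.≤-refl (ℕ.≤-trans 1≤E (ℕ.m≤n*m E 2)) (ℕ.≤-reflexive (sym (ℕ.m+[n∸m]≡n 1≤E)))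
    in σ , _ , repaired (λ Δ≡0 → ℚ.<-irrefl (sym Δ≡0) 0<Δ) rep , feasible , C≤ ,
       ℕ-bound⇒repairBound ε ε<1 (16 ℕ.+ factor) n 2≤m 1≤E
         (ℕ.≤-trans (ℕ.+-mono-≤ (ℕ.+-monoˡ-≤ (n ℕ.* m ℕ.+ m) (steps-project I rule π̂))
             (subst (λ k → t ℕ.≤ k ℕ.* ((9 ℕ.+ factor) ℕ.* (n ℕ.* m ℕ.* ((1 ℕ.+ m) ℕ.^ (4 ℕ.* E) ℕ.* G ℕ.^ (4 ℕ.* E))))) (ℕ.m+[n∸m]≡n 1≤E) t≤))
           (total-cost≤ factor (G ℕ.^ (4 ℕ.* E)) (inhabited⇒1≤n j) 2≤m 1≤E (ℕ.m^n>0 G {{ℕ.>-nonZero 1≤G}} (4 ℕ.* E))))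
    where
    σ̂ : Assignment n m
    σ̂ = value (project I rule π̂)

    σ̂-feasible : Feasible I σ̂
    σ̂-feasible j = proj₁ (project-projected I rule π̂ j)

    O-nonempty : Nonempty (overloaded I T σ̂)
    O-nonempty = overloaded-nonempty I 0<Δ

    σ* : Assignment n m
    σ* = proj₁ (IsMinimum.attained isError)

    σ*-optimal : Optimal I σ*
    σ*-optimal = proj₁ (proj₂ (IsMinimum.attained isError))

    C≤T : ⟦ Cmax I σ* ⟧ ≤ T
    -- The makespan of `σ*` is itself a minimum, so it is compared with a schedule `τ` attaining
    -- `opt`.
    C≤T = let τ , τ-feasible , Cτ≡opt = IsMinimum.attained isOPT in
      ℚ.≤-trans (⟦⟧-mono (subst (Cmax I σ* ℕ.≤_) Cτ≡opt (IsMinimum.lowerBound (proj₂ σ*-optimal) τ τ-feasible))) opt≤T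

    -- Project keeps π̂ j wherever σ* agrees with it, so σ* is no further from σ̂ than from π̂.
    moves≤E : moveJobs σ* σ̂ ℕ.≤ E
    moves≤E = subst (moveJobs σ* σ̂ ℕ.≤_) (proj₂ (proj₂ (IsMinimum.attained isError))) (moveJobs-mono agree)
      where
      agree : ∀ j → σ* j ≡ π̂ j → σ* j ≡ σ̂ j
      agree j eq = trans eq (sym (proj₂ (project-projected I rule π̂ j)
        (subst (_∈ Instance.Γ I j) eq (proj₁ σ*-optimal j))))

    -- This one job supplies all size conditions: it exists, so `1 ≤ n`; its two machines differ, so
    -- `2 ≤ m`; it is moved, so `1 ≤ E`.
    leaving : ∃[ j ] σ̂ j ≡ proj₁ O-nonempty × σ* j ≢ proj₁ O-nonempty
    leaving = leaves-larger-load I (overloaded⇒load-drops I {σ* = σ*} C≤T (proj₂ O-nonempty))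

    j : Fin n
    j = proj₁ leaving

    σ*j≢σ̂j : σ* j ≢ σ̂ j
    σ*j≢σ̂j eq = proj₂ (proj₂ leaving) (trans eq (proj₁ (proj₂ leaving)))

    2≤m : 2 ℕ.≤ m
    2≤m = distinct⇒2≤m σ*j≢σ̂j

    1≤E : 1 ℕ.≤ E
    1≤E = ℕ.≤-trans (1≤moveJobs σ* σ̂ σ*j≢σ̂j) moves≤E

    G : ℕ
    G = 2 ℕ.* gridSize (2 ℕ.* E) ε ℕ.+ 1

    1≤G : 1 ℕ.≤ G
    1≤G = ℕ.m≤n+m 1 (2 ℕ.* gridSize (2 ℕ.* E) ε)

    complete : ∀ {M} → 1 ℕ.≤ M → E ℕ.≤ M → value (globalRepairOracle P I T ε M σ̂) ≢ nothing
    complete 1≤M E≤M = oracle-complete P I T ε ε<1 σ̂-feasible O-nonempty 1≤M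
      (overloaded⊆touched I {σ̂ = σ̂} {σ*} C≤T)
      (ℕ.≤-trans (∣touched∣≤ σ* σ̂) (ℕ.*-monoʳ-≤ 2 moves≤M))
      (touched-repair I {T} {σ̂} {σ*} (proj₁ σ*-optimal) moves≤M) C≤T
      where moves≤M = ℕ.≤-trans moves≤E E≤M

    cheap : ∀ {M} → 1 ℕ.≤ M → M ℕ.≤ 2 ℕ.* E → 1 ℕ.+ steps (globalRepairOracle P I T ε M σ̂) ℕ.≤
            (9 ℕ.+ factor) ℕ.* (n ℕ.* m ℕ.* ((1 ℕ.+ m) ℕ.^ (4 ℕ.* E) ℕ.* G ℕ.^ (4 ℕ.* E)))
    cheap {M} 1≤M M≤2E = steps-oracle P I T ε ε<1 σ̂-feasible O-nonempty 1≤M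
      (subst (2 ℕ.* M ℕ.≤_) (sym (ℕ.*-assoc 2 2 E)) (ℕ.*-monoʳ-≤ 2 M≤2E))
      (ℕ.+-monoˡ-≤ 1 (ℕ.*-monoʳ-≤ 2 (gridSize-mono ε M≤2E))) 1≤G (inhabited⇒1≤n j) (ℕ.<⇒≤ 2≤m)
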